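{- Let $\mathcal{P}$ be the set of integer partitions satisfying all of the following: (i) adjacent parts do not differ by exactly $1$; (ii) even parts do not repeat; (iii) for all integers $j\ge 0$ and $0\le t\le 3$, $(2j+1)+(2j+1)+(2j+1+t)$ does not occur as a sub-partition; (iv) for all integers $j\ge 0$ and $0\le t\le 2$, $(2j+1-t)+(2j+1)+(2j+1)$ does not occur as a sub-partition; (v) for all integers $j\ge 0$, $(2j+1)+(2j+3)+(2j+5)$ does not occur as a sub-partition. Let $\mathcal{P}'$ be the set of $\pi\in\mathcal{P}$ in which $1$ does not appear as a part. Then, as formal power series in $x,q$, writing $N=i+2j+3k$, $$\sum_{\pi\in\mathcal{P}}x^{\ell(\pi)}q^{|\pi|}=\sum_{i,j,k\ge 0}(-1)^k\frac{x^{N}q^{N(N-1)+i+3k^2}}{(q;q)_i\,(q^4;q^4)_j\,(q^6;q^6)_k},$$ $$\sum_{\pi\in\mathcal{P}'}x^{\ell(\pi)}q^{|\pi|}=\sum_{i,j,k\ge 0}(-1)^k\frac{x^{N}q^{N(N-1)+2i+4j+3k^2+6k}}{(q;q)_i\,(q^4;q^4)_j\,(q^6;q^6)_k}.$$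
   Context: Partitions are finite weakly increasing sequences of positive integers (the empty partition is included); $\ell(\pi)$ is the number of parts and $|\pi|$ the sum of the parts of $\pi$. A sub-partition of a partition is a contiguous portion of it. For $n\ge 0$, $(a;q)_n=\prod_{0\le t<n}(1-aq^t)$. All identities are identities of formal power series. -}

module Defs where

open import Data.Bool.Base using (if_then_else_)
open import Data.Fin.Base using (Fin; zero; suc; toℕ)
open import Data.Integer.Base as ℤ using (ℤ; 0ℤ; 1ℤ; -1ℤ)
import Data.Integer.Properties as ℤ
open import Data.List.Base using (List; []; _∷_; length; map; foldr)
open import Data.List.Membership.Propositional using (_∉_)
open import Data.List.Relation.Binary.Infix.Heterogeneous using (Infix)
open import Data.List.Relation.Binary.Subset.Propositional using (_⊆_)
open import Data.List.Relation.Unary.All using (All)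
open import Data.List.Relation.Unary.AllPairs using (AllPairs)
open import Data.List.Relation.Unary.Linked using (Linked)
open import Data.List.Relation.Unary.Unique.Propositional using (Unique)
open import Data.Nat.Base using (ℕ; zero; suc; _+_; _*_; _∸_; _^_; _≤_; _<_; ∣_-_∣)
open import Data.Nat.Divisibility using (_∣_)
open import Data.Nat.ListAction using (sum)
open import Data.Nat.Properties using (_≟_)
open import Data.Product.Base using (_×_; _,_; ∃-syntax)
open import Data.Vec.Functional as Vector using (Vector)
open import Function.Base using (_∘_)
open import Relation.Binary.PropositionalEquality
open import Relation.Nullary.Decidable.Core using (does)
open import Relation.Nullary.Negation.Core using (¬_)

open import Algebra.Properties.Semiring.Sum ℤ.+-*-semiring
  using (sum⁺-syntax; sum-cong-≗)

------------------------------------------------------------------------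
-- Formal power series

-- ℤ[[q]]: f n is the coefficient of qⁿ.
QSeries : Set
QSeries = ℕ → ℤ

-- ℤ[[x,q]]: F m n is the coefficient of xᵐqⁿ.
XQSeries : Set
XQSeries = ℕ → QSeries

infix 4 _≈_

_≈_ : QSeries → QSeries → Set
f ≈ g = ∀ n → f n ≡ g n

infixr 8 _∙q^_
infixl 7 _·_ _/_
infixl 6 _-_
infixr 8 _↑_

_∙q^_ : ℤ → ℕ → QSeries
(c ∙q^ e) n = if does (n ≟ e) then c else 0ℤ

𝟙 : QSeries
𝟙 = 1ℤ ∙q^ 0

_-_ : QSeries → QSeries → QSeries
(f - g) n = f n ℤ.- g n

_·_ : QSeries → QSeries → QSeries
(f · g) n = ∑[ i ≤ n ] (f (toℕ i) ℤ.* g (n ∸ toℕ i))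

_↑_ : QSeries → ℕ → QSeries
f ↑ zero  = 𝟙
f ↑ suc t = f · f ↑ t

-- The coefficients gₙ, …, g₀ of g = 1/f for f with constant term 1: the
-- coefficient of qⁿ⁺¹ in f · g = 1 gives gₙ₊₁ = - ∑_{i ≤ n} fᵢ₊₁ gₙ₋ᵢ.
-- See ·-inverseʳ.
inverseCoeffs : QSeries → ∀ n → Vector ℤ (suc n)
inverseCoeffs f zero    = 1ℤ Vector.∷ Vector.[]
inverseCoeffs f (suc n) =
  (ℤ.- (∑[ i ≤ n ] (f (suc (toℕ i)) ℤ.* inverseCoeffs f n i)))
  Vector.∷ inverseCoeffs f n

inverse : QSeries → QSeries
inverse f n = inverseCoeffs f n zero

-- Meaningful only when g has constant term 1.
_/_ : QSeries → QSeries → QSeries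
f / g = f · inverse g

inverseCoeffs-lookup : ∀ f n i → inverseCoeffs f n i ≡ inverse f (n ∸ toℕ i)
inverseCoeffs-lookup f zero    zero    = refl
inverseCoeffs-lookup f (suc n) zero    = refl
inverseCoeffs-lookup f (suc n) (suc i) = inverseCoeffs-lookup f n i

·-inverseʳ : ∀ f → f 0 ≡ 1ℤ → f · inverse f ≈ 𝟙
·-inverseʳ f f₀≡1 zero rewrite f₀≡1 = refl
·-inverseʳ f f₀≡1 (suc n) = begin
  f 0 ℤ.* inverse f (suc n) ℤ.+ T  ≡⟨ cong₂ (λ c t → c ℤ.* inverse f (suc n) ℤ.+ t) f₀≡1 T≡S ⟩
  1ℤ ℤ.* (ℤ.- S) ℤ.+ S             ≡⟨ cong (ℤ._+ S) (ℤ.*-identityˡ (ℤ.- S)) ⟩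
  (ℤ.- S) ℤ.+ S                    ≡⟨ ℤ.+-inverseˡ S ⟩
  0ℤ                               ∎
  where
  open ≡-Reasoning
  S = ∑[ i ≤ n ] (f (suc (toℕ i)) ℤ.* inverseCoeffs f n i)
  T = ∑[ i ≤ n ] (f (suc (toℕ i)) ℤ.* inverse f (n ∸ toℕ i))
  T≡S : T ≡ S
  T≡S = sum-cong-≗
    (λ i → cong (f (suc (toℕ i)) ℤ.*_) (sym (inverseCoeffs-lookup f n i)))

-- (a ; r)ₙ = ∏_{0 ≤ t < n} (1 - a rᵗ)
poch : (a r : QSeries) → ℕ → QSeries
poch a r zero    = 𝟙
poch a r (suc n) = poch a r n · (𝟙 - a · r ↑ n)

-- (qˢ ; qˢ)ₙ
qpoch : ℕ → ℕ → QSeries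
qpoch s = poch (1ℤ ∙q^ s) (1ℤ ∙q^ s)

infix 6 x^_∙_

x^_∙_ : ℕ → QSeries → XQSeries
(x^ N ∙ f) m = if does (m ≟ N) then f else λ _ → 0ℤ

-- ∑_{a ∈ I} F a = S as formal power series: each coefficient of the sum
-- over finite subsets of I is eventually constant, along the finite
-- subsets ordered by inclusion, with value the coefficient of S.
HasSum : {A : Set} → (A → Set) → (A → XQSeries) → XQSeries → Set
HasSum {A} I F S = ∀ m n → ∃[ as ] (Unique as × All I as ×
  (∀ (bs : List A) → Unique bs → All I bs → as ⊆ bs →
    foldr ℤ._+_ 0ℤ (map (λ b → F b m n) bs) ≡ S m n))

------------------------------------------------------------------------
-- Partitions

record IsPartition (π : List ℕ) : Set where
  field
    positive   : All (0 <_) π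
    increasing : Linked _≤_ π

_isSubPartitionOf_ : List ℕ → List ℕ → Set
_isSubPartitionOf_ = Infix _≡_

record 𝒫 (π : List ℕ) : Set where
  field
    isPartition : IsPartition π
    i   : Linked (λ a b → ∣ a - b ∣ ≢ 1) π
    ii  : AllPairs (λ a b → 2 ∣ a → a ≢ b) π
    iii : ∀ j t → t ≤ 3 → let a = 2 * j + 1 in
          ¬ (a ∷ a ∷ a + t ∷ []) isSubPartitionOf π
    -- When a < t the truncated a ∸ t is 0, which like a negative integer is
    -- never a part.
    iv  : ∀ j t → t ≤ 2 → let a = 2 * j + 1 in
          ¬ (a ∸ t ∷ a ∷ a ∷ []) isSubPartitionOf π
    v   : ∀ j →
          ¬ (2 * j + 1 ∷ 2 * j + 3 ∷ 2 * j + 5 ∷ []) isSubPartitionOf π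

𝒫′ : List ℕ → Set
𝒫′ π = 𝒫 π × 1 ∉ π

-- x^ℓ(π) q^|π|
weight : List ℕ → XQSeries
weight π = x^ length π ∙ (1ℤ ∙q^ sum π)

------------------------------------------------------------------------
-- The summands of the triple series

N : ℕ × ℕ × ℕ → ℕ
N (i , j , k) = i + 2 * j + 3 * k

-- (-1)ᵏ x^N q^e / ((q;q)ᵢ (q⁴;q⁴)ⱼ (q⁶;q⁶)ₖ)
summand : (e : ℕ × ℕ × ℕ → ℕ) → ℕ × ℕ × ℕ → XQSeries
summand e p@(i , j , k) =
  x^ N p ∙ (((-1ℤ ℤ.^ k) ∙q^ e p) / (qpoch 1 i · qpoch 4 j · qpoch 6 k))

-- N * (N ∸ 1) is exact: it vanishes at N = 0.
exponent exponent′ : ℕ × ℕ × ℕ → ℕ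
exponent  p@(i , j , k) = N p * (N p ∸ 1) + i + 3 * k ^ 2
exponent′ p@(i , j , k) = N p * (N p ∸ 1) + 2 * i + 4 * j + 3 * k ^ 2 + 6 * k

-- Reading off the smallest parts, the generating functions F(x) of 𝒫 and G(x) of 𝒫′ satisfy
--   G(x) = F(xq²) + xq² G(xq²)  and  F(x) = G(x) + xq K(x),
--   K(x) = G(xq²) + xq F(xq⁴) + xq³ G(xq⁴),
-- and these equations determine F and G, since G(xqᵉ) and F(xqᵉ) tend to 1 as e → ∞.
-- For the triple series the first equation comes from multiplying the summand by 1 - qⁱ.
-- Similarly, multiplication by 1 - qⁱ, 1 - q⁴ʲ and 1 - q⁶ᵏ shows that the defect
-- D(x) = F(x) - G(x) - xq K(x) satisfies D(x) = xq D(xq²), hence D = 0.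

module Submission where

open import Data.Bool.Base using (true; false)
open import Data.Integer.Base as ℤ using (ℤ; 0ℤ; 1ℤ; -1ℤ)
import Data.Integer.Properties as ℤ
import Data.Integer.Tactic.RingSolver as ℤ-Solver
open import Data.List.Base using (List; []; _∷_; [_]; _++_; map; foldr; length)
import Data.List.Properties as List
open import Data.List.Membership.Propositional using (_∈_; _∉_)
open import Data.List.Membership.Propositional.Properties
  using (∈-∃++; ∈-map⁺; ∈-map⁻; ∈-++⁺ˡ; ∈-++⁺ʳ; ∈-++⁻)
open import Data.List.Relation.Binary.Disjoint.Propositional using (Disjoint)
open import Data.List.Relation.Binary.Infix.Heterogeneous using (here; there)
open import Data.List.Relation.Binary.Permutation.Propositional using (_↭_; ↭⇒↭ₛ)
import Data.List.Relation.Binary.Permutation.Propositional.Properties as ↭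
import Data.List.Relation.Binary.Permutation.Setoid.Properties as ↭ₛ
open import Data.List.Relation.Binary.Prefix.Heterogeneous using ([]; _∷_)
open import Data.List.Relation.Binary.Subset.Propositional using (_⊆_)
open import Data.List.Relation.Unary.All as All using (All; []; _∷_)
import Data.List.Relation.Unary.All.Properties as All
open import Data.List.Relation.Unary.AllPairs as AllPairs using ([]; _∷_)
open import Data.List.Relation.Unary.Any using (here; there)
open import Data.List.Relation.Unary.Linked as Linked using (Linked; []; [-]; _∷_)
import Data.List.Relation.Unary.Linked.Properties as Linked
open import Data.List.Relation.Unary.Unique.Propositional using (Unique)
import Data.List.Relation.Unary.Unique.Propositional.Properties as Unique
open import Data.Nat.Base hiding (_/_)
open import Data.Nat.Divisibility
  using (_∣_; divides; ∣m∣n⇒∣m+n; ∣m+n∣m⇒∣n; ∣-refl; m∣m*n; ∣1⇒≡1; _∣0)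
open import Data.Nat.ListAction using (sum)
open import Data.Nat.Properties
import Data.Nat.Tactic.RingSolver as ℕ-Solver
open import Data.Product.Base using (_×_; _,_; proj₁; proj₂; ∃-syntax)
open import Data.Sum.Base using (inj₁; inj₂)
open import Data.Unit.Base using (tt)
open import Function.Base using (_∘_; flip)
open import Relation.Binary.PropositionalEquality hiding ([_])
open import Relation.Nullary.Decidable using (yes; no; dec-true; dec-false)
open import Relation.Nullary.Negation using (¬_; contradiction)
open import Relation.Unary using (U)
open import Defs

-- The ring ℤ[[q]]

-- Both triple series lie in one family, with exponent N(N-1) + 3k² + ai + bj + ck of q: (a,b,c) is
-- (1,0,0) for F and (2,4,6) for G. Replacing x by xq² adds (2,4,6) to (a,b,c). Multiplying the
-- summand by 1 - qⁱ, 1 - q⁴ʲ or 1 - q⁶ᵏ gives the difference between (a,b,c) and (a+1,b,c),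
-- (a,b+4,c) or (a,b,c+6); the factor also cancels in a denominator, so reindexing leaves a monomial
-- times a series of the family. F and G are linked through (2,0,0) and (2,4,0). The three terms of
-- K are what may follow a smallest part 1: parts from 4 on; another 1, then parts from 5 on by
-- (iii); or 3, then parts from 6 on, since 3, 4 and 5 are excluded by (iv), (i) and (v). Adding an
-- even number to all parts respects every condition except positivity, so the same analysis applies
-- with 1 + e in place of 1 for even e. That the equations determine F and G is not argued for
-- abstract solutions: the equations are run as a recursion that lists partitions, with fuel, and
-- the lists are compared with the series up to a degree in q.

+-congˡ : ∀ x {y z} → y ≡ z → x ℤ.+ y ≡ x ℤ.+ z
+-congˡ x = cong (λ y → x ℤ.+ y)

·-cong : ∀ {f f′ g g′} → f ≈ f′ → g ≈ g′ → f · g ≈ f′ · g′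
·-cong p r zero    = cong (ℤ._+ 0ℤ) (cong₂ ℤ._*_ (p 0) (r 0))
·-cong p r (suc n) = cong₂ ℤ._+_ (cong₂ ℤ._*_ (p 0) (r (suc n))) (·-cong (p ∘ suc) r n)

·-congˡ : ∀ f {g g′} → g ≈ g′ → f · g ≈ f · g′
·-congˡ f = ·-cong {f} (λ _ → refl)

·-congʳ : ∀ g {f f′} → f ≈ f′ → f · g ≈ f′ · g
·-congʳ g p = ·-cong {g = g} p (λ _ → refl)

-- The sum in `_·_` unfolds by its first term; commutativity also needs the last term split off.
·-tailʳ : ∀ f g n → (f · g) (suc n) ≡ f (suc n) ℤ.* g 0 ℤ.+ (f · g ∘ suc) n
·-tailʳ f g zero    = lemma (f 0) (f 1) (g 0) (g 1)
  where
  lemma : ∀ a b c d → a ℤ.* d ℤ.+ (b ℤ.* c ℤ.+ 0ℤ) ≡ b ℤ.* c ℤ.+ (a ℤ.* d ℤ.+ 0ℤ)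
  lemma = ℤ-Solver.solve-∀
·-tailʳ f g (suc n) = trans (+-congˡ (f 0 ℤ.* g (2 + n)) (·-tailʳ (f ∘ suc) g n))
  (lemma (f 0 ℤ.* g (2 + n)) (f (2 + n) ℤ.* g 0) _)
  where
  lemma : ∀ a b c → a ℤ.+ (b ℤ.+ c) ≡ b ℤ.+ (a ℤ.+ c)
  lemma = ℤ-Solver.solve-∀

·-comm : ∀ f g → f · g ≈ g · f
·-comm f g zero    = cong (ℤ._+ 0ℤ) (ℤ.*-comm (f 0) (g 0))
·-comm f g (suc n) = trans (·-tailʳ f g n)
  (cong₂ ℤ._+_ (ℤ.*-comm (f (suc n)) (g 0)) (·-comm f (g ∘ suc) n))

-- The shape c f + g is that of `(f · g) ∘ suc`, which is by definition `f 0` times `g ∘ suc` plus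
-- `f ∘ suc · g`. This is what the induction for associativity meets.
·-linearˡ : ∀ c f g h → (λ n → c ℤ.* f n ℤ.+ g n) · h ≈ λ n → c ℤ.* (f · h) n ℤ.+ (g · h) n
·-linearˡ c f g h zero    = lemma c (f 0) (g 0) (h 0)
  where
  lemma : ∀ c f g h → (c ℤ.* f ℤ.+ g) ℤ.* h ℤ.+ 0ℤ ≡ c ℤ.* (f ℤ.* h ℤ.+ 0ℤ) ℤ.+ (g ℤ.* h ℤ.+ 0ℤ)
  lemma = ℤ-Solver.solve-∀
·-linearˡ c f g h (suc n) =
  trans (+-congˡ ((c ℤ.* f 0 ℤ.+ g 0) ℤ.* h (suc n)) (·-linearˡ c (f ∘ suc) (g ∘ suc) h n))
    (lemma c (f 0) (g 0) (h (suc n)) ((f ∘ suc · h) n) ((g ∘ suc · h) n))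
  where
  lemma : ∀ c f g h x y → (c ℤ.* f ℤ.+ g) ℤ.* h ℤ.+ (c ℤ.* x ℤ.+ y) ≡
    c ℤ.* (f ℤ.* h ℤ.+ x) ℤ.+ (g ℤ.* h ℤ.+ y)
  lemma = ℤ-Solver.solve-∀

·-assoc : ∀ f g h → (f · g) · h ≈ f · (g · h)
·-assoc f g h zero    = lemma (f 0) (g 0) (h 0)
  where
  lemma : ∀ f g h → (f ℤ.* g ℤ.+ 0ℤ) ℤ.* h ℤ.+ 0ℤ ≡ f ℤ.* (g ℤ.* h ℤ.+ 0ℤ) ℤ.+ 0ℤ
  lemma = ℤ-Solver.solve-∀
·-assoc f g h (suc n) =
  trans (+-congˡ ((f · g) 0 ℤ.* h (suc n))
          (trans (·-linearˡ (f 0) (g ∘ suc) (f ∘ suc · g) h n)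
                 (+-congˡ (f 0 ℤ.* (g ∘ suc · h) n) (·-assoc (f ∘ suc) g h n))))
    (lemma (f 0) (g 0) (h (suc n)) ((g ∘ suc · h) n) ((f ∘ suc · (g · h)) n))
  where
  lemma : ∀ f g h x y → (f ℤ.* g ℤ.+ 0ℤ) ℤ.* h ℤ.+ (f ℤ.* x ℤ.+ y) ≡ f ℤ.* (g ℤ.* h ℤ.+ x) ℤ.+ y
  lemma = ℤ-Solver.solve-∀

infixr 7 q^_∗_

q^_∗_ : ℕ → QSeries → QSeries
(q^ zero ∗ f) n        = f n
(q^ suc e ∗ f) zero    = 0ℤ
(q^ suc e ∗ f) (suc n) = (q^ e ∗ f) n

q∗-cong : ∀ e {f g} → f ≈ g → q^ e ∗ f ≈ q^ e ∗ g
q∗-cong zero    p n       = p n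
q∗-cong (suc e) p zero    = refl
q∗-cong (suc e) p (suc n) = q∗-cong e p n

q∗-+ : ∀ e e′ f → q^ e ∗ q^ e′ ∗ f ≈ q^ (e + e′) ∗ f
q∗-+ zero    e′ f n       = refl
q∗-+ (suc e) e′ f zero    = refl
q∗-+ (suc e) e′ f (suc n) = q∗-+ e e′ f n

-- The operation is a parameter because sums, differences in either order and scalar multiples all
-- occur below.
q∗-map₂ : ∀ (_⊕_ : ℤ → ℤ → ℤ) → 0ℤ ⊕ 0ℤ ≡ 0ℤ → ∀ e f g →
          (q^ e ∗ λ n → f n ⊕ g n) ≈ λ n → (q^ e ∗ f) n ⊕ (q^ e ∗ g) n
q∗-map₂ _⊕_ z zero    f g n       = refl
q∗-map₂ _⊕_ z (suc e) f g zero    = sym z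
q∗-map₂ _⊕_ z (suc e) f g (suc n) = q∗-map₂ _⊕_ z e f g n

q∗-< : ∀ e f {n} → n < e → (q^ e ∗ f) n ≡ 0ℤ
q∗-< (suc e) f {zero}  _         = refl
q∗-< (suc e) f {suc n} (s<s n<e) = q∗-< e f n<e

0-· : ∀ f → (λ _ → 0ℤ) · f ≈ λ _ → 0ℤ
0-· f zero    = refl
0-· f (suc n) = trans (ℤ.+-identityˡ _) (0-· f n)

∙q^-· : ∀ c e f → (c ∙q^ e) · f ≈ q^ e ∗ λ n → c ℤ.* f n
∙q^-· c zero    f zero    = ℤ.+-identityʳ _
∙q^-· c zero    f (suc n) = trans (+-congˡ (c ℤ.* f (suc n)) (0-· f n)) (ℤ.+-identityʳ _)
∙q^-· c (suc e) f zero    = refl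
∙q^-· c (suc e) f (suc n) = trans (ℤ.+-identityˡ _) (∙q^-· c e f n)

·-identityˡ : ∀ f → 𝟙 · f ≈ f
·-identityˡ f n = trans (∙q^-· 1ℤ 0 f n) (ℤ.*-identityˡ (f n))

q∗-· : ∀ e f g → (q^ e ∗ f) · g ≈ q^ e ∗ (f · g)
q∗-· zero    f g n       = refl
q∗-· (suc e) f g zero    = refl
q∗-· (suc e) f g (suc n) = trans (ℤ.+-identityˡ _) (q∗-· e f g n)

-‿· : ∀ f g h → (f - g) · h ≈ (f · h) - (g · h)
-‿· f g h n = trans (·-congʳ h (λ k → lemma (f k) (g k)) n)
  (trans (·-linearˡ -1ℤ g f h n) (sym (lemma ((f · h) n) ((g · h) n))))
  where
  lemma : ∀ x y → x ℤ.- y ≡ -1ℤ ℤ.* y ℤ.+ x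
  lemma = ℤ-Solver.solve-∀

inverse-unique : ∀ f g → f 0 ≡ 1ℤ → f · g ≈ 𝟙 → g ≈ inverse f
inverse-unique f g f₀≡1 fg≈𝟙 n = begin
  g n                     ≡⟨ ·-identityˡ g n ⟨
  (𝟙 · g) n               ≡⟨ ·-congʳ g (·-inverseʳ f f₀≡1) n ⟨
  ((f · inverse f) · g) n ≡⟨ ·-congʳ g (·-comm f (inverse f)) n ⟩
  ((inverse f · f) · g) n ≡⟨ ·-assoc (inverse f) f g n ⟩
  (inverse f · (f · g)) n ≡⟨ ·-congˡ (inverse f) fg≈𝟙 n ⟩
  (inverse f · 𝟙) n       ≡⟨ ·-comm (inverse f) 𝟙 n ⟩
  (𝟙 · inverse f) n       ≡⟨ ·-identityˡ (inverse f) n ⟩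
  inverse f n             ∎
  where open ≡-Reasoning

inverse-cancel : ∀ f g u → f 0 ≡ 1ℤ → g 0 ≡ 1ℤ → g ≈ f · u → u · inverse g ≈ inverse f
inverse-cancel f g u f₀≡1 g₀≡1 g≈fu = inverse-unique f (u · inverse g) f₀≡1 λ n → begin
  (f · (u · inverse g)) n ≡⟨ ·-assoc f u (inverse g) n ⟨
  ((f · u) · inverse g) n ≡⟨ ·-congʳ (inverse g) g≈fu n ⟨
  (g · inverse g) n       ≡⟨ ·-inverseʳ g g₀≡1 n ⟩
  𝟙 n                     ∎
  where open ≡-Reasoning

∙q^-↑ : ∀ s n → (1ℤ ∙q^ s) · (1ℤ ∙q^ s) ↑ n ≈ q^ (s * suc n) ∗ 𝟙
∙q^-↑ s n k = trans
  (trans (∙q^-· 1ℤ s ((1ℤ ∙q^ s) ↑ n) k)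
         (q∗-cong s (λ m → ℤ.*-identityˡ (((1ℤ ∙q^ s) ↑ n) m)) k))
  (rest n k)
  where
  rest : ∀ n → q^ s ∗ (1ℤ ∙q^ s) ↑ n ≈ q^ (s * suc n) ∗ 𝟙
  rest zero    k = cong (λ e → (q^ e ∗ 𝟙) k) (sym (*-identityʳ s))
  rest (suc n) k = begin
    (q^ s ∗ (1ℤ ∙q^ s) ↑ suc n) k   ≡⟨ q∗-cong s (∙q^-↑ s n) k ⟩
    (q^ s ∗ q^ (s * suc n) ∗ 𝟙) k   ≡⟨ q∗-+ s _ 𝟙 k ⟩
    (q^ (s + s * suc n) ∗ 𝟙) k      ≡⟨ cong (λ e → (q^ e ∗ 𝟙) k) (sym (*-suc s (suc n))) ⟩
    (q^ (s * suc (suc n)) ∗ 𝟙) k    ∎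
    where open ≡-Reasoning

-- The factor 1 - q^(s(n+1)) of (q^s;q^s)_{n+1}, in the form in which it occurs in poch.
factor : ℕ → ℕ → QSeries
factor s n = 𝟙 - (1ℤ ∙q^ s) · (1ℤ ∙q^ s) ↑ n

factor-· : ∀ s n f → factor s n · f ≈ f - q^ (s * suc n) ∗ f
factor-· s n f k = begin
  (factor s n · f) k  ≡⟨ -‿· 𝟙 ((1ℤ ∙q^ s) · (1ℤ ∙q^ s) ↑ n) f k ⟩
  (𝟙 · f) k ℤ.- ((1ℤ ∙q^ s) · (1ℤ ∙q^ s) ↑ n · f) k
    ≡⟨ cong₂ ℤ._-_ (·-identityˡ f k) (·-congʳ f (∙q^-↑ s n) k) ⟩
  f k ℤ.- ((q^ (s * suc n) ∗ 𝟙) · f) k        ≡⟨ cong (λ c → f k ℤ.- c) (q∗-· (s * suc n) 𝟙 f k) ⟩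
  f k ℤ.- (q^ (s * suc n) ∗ (𝟙 · f)) k        ≡⟨ cong (λ c → f k ℤ.- c) (q∗-cong (s * suc n) (·-identityˡ f) k) ⟩
  (f - q^ (s * suc n) ∗ f) k                  ∎
  where open ≡-Reasoning

qpoch-0 : ∀ s n → qpoch (suc s) n 0 ≡ 1ℤ
qpoch-0 s zero    = refl
qpoch-0 s (suc n) rewrite qpoch-0 s n = refl

-- The denominators

denominator : ℕ × ℕ × ℕ → QSeries
denominator (i , j , k) = qpoch 1 i · qpoch 4 j · qpoch 6 k

denominator-0 : ∀ t → denominator t 0 ≡ 1ℤ
denominator-0 (i , j , k) rewrite qpoch-0 0 i | qpoch-0 3 j | qpoch-0 5 k = refl

denominator-sucₖ : ∀ i j k → denominator (i , j , suc k) ≈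
  denominator (i , j , k) · factor 6 k
denominator-sucₖ i j k n = sym (·-assoc (qpoch 1 i · qpoch 4 j) (qpoch 6 k) (factor 6 k) n)

·-swap : ∀ f g h → (f · g) · h ≈ (f · h) · g
·-swap f g h n = trans (·-assoc f g h n)
  (trans (·-congˡ f (·-comm g h) n) (sym (·-assoc f h g n)))

denominator-sucⱼ : ∀ i j k → denominator (i , suc j , k) ≈
  denominator (i , j , k) · factor 4 j
denominator-sucⱼ i j k n =
  trans (·-congʳ (qpoch 6 k) (λ n → sym (·-assoc (qpoch 1 i) (qpoch 4 j) (factor 4 j) n)) n)
        (·-swap (qpoch 1 i · qpoch 4 j) (factor 4 j) (qpoch 6 k) n)

denominator-sucᵢ : ∀ i j k → denominator (suc i , j , k) ≈
  denominator (i , j , k) · factor 1 i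
denominator-sucᵢ i j k n =
  trans (·-congʳ (qpoch 6 k) (·-swap (qpoch 1 i) (factor 1 i) (qpoch 4 j)) n)
        (·-swap (qpoch 1 i · qpoch 4 j) (factor 1 i) (qpoch 6 k) n)

-- The difference on the left is multiplication by `factor s n`, which cancels the extra factor of
-- `denominator t′`.
inverse-cancel-q : ∀ s n t t′ →
  denominator t′ ≈ denominator t · factor s n →
  inverse (denominator t′) - q^ (s * suc n) ∗ inverse (denominator t′) ≈ inverse (denominator t)
inverse-cancel-q s n t t′ p k = trans (sym (factor-· s n (inverse (denominator t′)) k))
  (inverse-cancel (denominator t) (denominator t′) (factor s n) (denominator-0 t) (denominator-0 t′) p k)

-- Finite sums

total : ∀ {A : Set} → (A → ℤ) → List A → ℤ
total φ as = foldr ℤ._+_ 0ℤ (map φ as)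

total-cong : ∀ {A : Set} {φ ψ : A → ℤ} {as} → All (λ a → φ a ≡ ψ a) as → total φ as ≡ total ψ as
total-cong []       = refl
total-cong (p ∷ ps) = cong₂ ℤ._+_ p (total-cong ps)

total-0 : ∀ {A : Set} {φ : A → ℤ} {as} → All (λ a → φ a ≡ 0ℤ) as → total φ as ≡ 0ℤ
total-0 []       = refl
total-0 (p ∷ ps) = cong₂ ℤ._+_ p (total-0 ps)

total-map : ∀ {A B : Set} (φ : B → ℤ) (g : A → B) as → total φ (map g as) ≡ total (φ ∘ g) as
total-map φ g as = cong (foldr ℤ._+_ 0ℤ) (sym (List.map-∘ as))

total-++ : ∀ {A : Set} (φ : A → ℤ) as bs → total φ (as ++ bs) ≡ total φ as ℤ.+ total φ bs
total-++ φ []       bs = sym (ℤ.+-identityˡ (total φ bs))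
total-++ φ (a ∷ as) bs = trans (+-congˡ (φ a) (total-++ φ as bs))
  (sym (ℤ.+-assoc (φ a) (total φ as) (total φ bs)))

total-- : ∀ {A : Set} (φ ψ : A → ℤ) as →
          total (λ a → φ a ℤ.- ψ a) as ≡ total φ as ℤ.- total ψ as
total-- φ ψ []       = refl
total-- φ ψ (a ∷ as) = trans (+-congˡ (φ a ℤ.- ψ a) (total-- φ ψ as))
  (lemma (φ a) (ψ a) (total φ as) (total ψ as))
  where
  lemma : ∀ a b c d → (a ℤ.- b) ℤ.+ (c ℤ.- d) ≡ (a ℤ.+ c) ℤ.- (b ℤ.+ d)
  lemma = ℤ-Solver.solve-∀

q∗-total : ∀ {A : Set} e (f : A → QSeries) as n →
           total (λ a → (q^ e ∗ f a) n) as ≡ (q^ e ∗ λ n → total (λ a → f a n) as) n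
q∗-total zero    f as n       = refl
q∗-total (suc e) f as zero    = total-0 (All.universal (λ _ → refl) as)
q∗-total (suc e) f as (suc n) = q∗-total e f as n

total-↭ : ∀ {A : Set} (φ : A → ℤ) {as bs} → as ↭ bs → total φ as ≡ total φ bs
total-↭ φ p = ↭ₛ.foldr-commMonoid (setoid ℤ) ℤ.+-0-isCommutativeMonoid (↭⇒↭ₛ (↭.map⁺ φ p))

-- Each entry of `as` is moved to the front of `bs` by a permutation and removed from both lists;
-- the values at what finally remains of `bs` vanish.
total-⊆ : ∀ {A : Set} (φ : A → ℤ) {as bs} → Unique as → Unique bs → as ⊆ bs →
          All (λ b → b ∉ as → φ b ≡ 0ℤ) bs → total φ bs ≡ total φ as
total-⊆ φ {[]}     {bs} _ _ _ vanish = total-0 (All.map (λ p → p λ ()) vanish)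
total-⊆ φ {a ∷ as} {bs} (a∉as ∷ uas) ubs as⊆bs vanish
  with ys , zs , refl ← ∈-∃++ (as⊆bs (here refl))
  with p ← ↭.shift a ys zs
  with a∉ ∷ u ← ↭ₛ.Unique-resp-↭ (setoid _) (↭⇒↭ₛ p) ubs
  with _ ∷ v ← ↭.All-resp-↭ p vanish
  = trans (total-↭ φ p) (+-congˡ (φ a) (total-⊆ φ uas u as⊆ (All.tabulate vanish′)))
  where
  as⊆ : as ⊆ ys ++ zs
  as⊆ b∈as with ↭.∈-resp-↭ p (as⊆bs (there b∈as))
  ... | here refl = contradiction refl (All.lookup a∉as b∈as)
  ... | there b∈  = b∈
  vanish′ : ∀ {b} → b ∈ ys ++ zs → b ∉ as → φ b ≡ 0ℤ
  vanish′ b∈ b∉as = All.lookup v b∈ λ where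
    (here refl)  → All.lookup a∉ b∈ refl
    (there b∈as) → b∉as b∈as

hasSum : ∀ {A : Set} {I : A → Set} {F : A → XQSeries} {S : XQSeries} (support : ℕ → ℕ → List A) →
         (∀ m n → Unique (support m n)) → (∀ m n → All I (support m n)) →
         (∀ m n a → I a → a ∉ support m n → F a m n ≡ 0ℤ) →
         (∀ m n → total (λ a → F a m n) (support m n) ≡ S m n) → HasSum I F S
hasSum {F = F} support unique sound complete value m n =
  support m n , unique m n , sound m n , λ bs ubs ibs s⊆bs →
    trans (total-⊆ (λ a → F a m n) (unique m n) ubs s⊆bs (All.map (λ {b} → complete m n b) ibs))
          (value m n)

x^∙-≡ : ∀ m f n → (x^ m ∙ f) m n ≡ f n
x^∙-≡ m f n rewrite dec-true (m ≟ m) refl = refl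

x^∙-≢ : ∀ {m k} f n → m ≢ k → (x^ k ∙ f) m n ≡ 0ℤ
x^∙-≢ {m} {k} f n m≢k rewrite dec-false (m ≟ k) m≢k = refl

-- Multiplication by monomials

infixr 7 x^_q^_∗_

-- q^ d ∗_ also serves as multiplication by xᵈ, applied to the sequence of coefficients of xᵐ.
x^_q^_∗_ : ℕ → ℕ → XQSeries → XQSeries
(x^ d q^ e ∗ F) m n = (q^ d ∗ λ m → (q^ e ∗ F m) n) m

q∗-0 : ∀ e → q^ e ∗ (λ _ → 0ℤ) ≈ λ _ → 0ℤ
q∗-0 zero    n       = refl
q∗-0 (suc e) zero    = refl
q∗-0 (suc e) (suc n) = q∗-0 e n

q∗-swap : ∀ d e (F : XQSeries) m n →
  (q^ e ∗ λ n → (q^ d ∗ λ m → F m n) m) n ≡ (x^ d q^ e ∗ F) m n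
q∗-swap zero    e F m       n = refl
q∗-swap (suc d) e F zero    n = q∗-0 e n
q∗-swap (suc d) e F (suc m) n = q∗-swap d e F m n

x∗-cong : ∀ d e {F G : XQSeries} → (∀ m → F m ≈ G m) → ∀ m → (x^ d q^ e ∗ F) m ≈ (x^ d q^ e ∗ G) m
x∗-cong d e p m n = q∗-cong d (λ m → q∗-cong e (p m) n) m

x∗-+ : ∀ d e d′ e′ F m → (x^ d q^ e ∗ x^ d′ q^ e′ ∗ F) m ≈ (x^ (d + d′) q^ (e + e′) ∗ F) m
x∗-+ d e d′ e′ F m n = begin
  (x^ d q^ e ∗ x^ d′ q^ e′ ∗ F) m n
    ≡⟨ q∗-cong d (λ m → q∗-swap d′ e (λ m n → (q^ e′ ∗ F m) n) m n) m ⟩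
  (q^ d ∗ q^ d′ ∗ λ m → (q^ e ∗ q^ e′ ∗ F m) n) m ≡⟨ q∗-+ d d′ _ m ⟩
  (q^ (d + d′) ∗ λ m → (q^ e ∗ q^ e′ ∗ F m) n) m  ≡⟨ q∗-cong (d + d′) (λ m → q∗-+ e e′ (F m) n) m ⟩
  (x^ (d + d′) q^ (e + e′) ∗ F) m n               ∎
  where open ≡-Reasoning

x∗-map₂ : ∀ (_⊕_ : ℤ → ℤ → ℤ) → 0ℤ ⊕ 0ℤ ≡ 0ℤ → ∀ d e F G m n →
          (x^ d q^ e ∗ λ m n → F m n ⊕ G m n) m n ≡ (x^ d q^ e ∗ F) m n ⊕ (x^ d q^ e ∗ G) m n
x∗-map₂ _⊕_ z d e F G m n =
  trans (q∗-cong d (λ m → q∗-map₂ _⊕_ z e (F m) (G m) n) m) (q∗-map₂ _⊕_ z d _ _ m)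

-- Triples (i , j , k) with given N

sucᵢ sucⱼ sucₖ : ℕ × ℕ × ℕ → ℕ × ℕ × ℕ
sucᵢ (i , j , k) = suc i , j , k
sucⱼ (i , j , k) = i , suc j , k
sucₖ (i , j , k) = i , j , suc k

N-sucⱼ : ∀ t → N (sucⱼ t) ≡ 2 + N t
N-sucⱼ (i , j , k) = lemma i j k
  where
  lemma : ∀ i j k → i + 2 * suc j + 3 * k ≡ 2 + (i + 2 * j + 3 * k)
  lemma = ℕ-Solver.solve-∀

N-sucₖ : ∀ t → N (sucₖ t) ≡ 3 + N t
N-sucₖ (i , j , k) = lemma i j k
  where
  lemma : ∀ i j k → i + 2 * j + 3 * suc k ≡ 3 + (i + 2 * j + 3 * k)
  lemma = ℕ-Solver.solve-∀

-- The recursion peels off one j here and one k in `triples`, so that reindexing a sum along `sucⱼ`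
-- or `sucₖ` is largely a matter of unfolding.
triples₀ : ℕ → List (ℕ × ℕ × ℕ)
triples₀ 0             = [ 0 , 0 , 0 ]
triples₀ 1             = [ 1 , 0 , 0 ]
triples₀ (suc (suc m)) = (2 + m , 0 , 0) ∷ map sucⱼ (triples₀ m)

triples : ℕ → List (ℕ × ℕ × ℕ)
triples 0                   = triples₀ 0
triples 1                   = triples₀ 1
triples 2                   = triples₀ 2
triples (suc (suc (suc m))) = triples₀ (3 + m) ++ map sucₖ (triples m)

triples₀-k : ∀ m → All (λ (_ , _ , k) → k ≡ 0) (triples₀ m)
triples₀-k 0             = refl ∷ []
triples₀-k 1             = refl ∷ []
triples₀-k (suc (suc m)) = refl ∷ All.map⁺ (triples₀-k m)

triples₀-N : ∀ m → All (λ t → N t ≡ m) (triples₀ m)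
triples₀-N 0             = refl ∷ []
triples₀-N 1             = refl ∷ []
triples₀-N (suc (suc m)) = trans (+-identityʳ _) (+-identityʳ _) ∷
  All.map⁺ (All.map (λ {t} p → trans (N-sucⱼ t) (cong (2 +_) p)) (triples₀-N m))

triples-N : ∀ m → All (λ t → N t ≡ m) (triples m)
triples-N 0                   = triples₀-N 0
triples-N 1                   = triples₀-N 1
triples-N 2                   = triples₀-N 2
triples-N (suc (suc (suc m))) = All.++⁺ (triples₀-N (3 + m))
  (All.map⁺ (All.map (λ {t} p → trans (N-sucₖ t) (cong (3 +_) p)) (triples-N m)))

triples₀-unique : ∀ m → Unique (triples₀ m)
triples₀-unique 0             = [] ∷ []
triples₀-unique 1             = [] ∷ []
triples₀-unique (suc (suc m)) = All.map⁺ (All.universal (λ _ ()) _) ∷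
  Unique.map⁺ (λ { refl → refl }) (triples₀-unique m)

triples-unique : ∀ m → Unique (triples m)
triples-unique 0                   = triples₀-unique 0
triples-unique 1                   = triples₀-unique 1
triples-unique 2                   = triples₀-unique 2
triples-unique (suc (suc (suc m))) =
  Unique.++⁺ (triples₀-unique (3 + m)) (Unique.map⁺ (λ { refl → refl }) (triples-unique m))
    λ (t∈₀ , t∈) → k≢0 (∈-map⁻ sucₖ t∈) (All.lookup (triples₀-k (3 + m)) t∈₀)
  where
  k≢0 : ∀ {t} → ∃[ s ] (s ∈ triples m × t ≡ sucₖ s) → proj₂ (proj₂ t) ≢ 0
  k≢0 (_ , _ , refl) ()

i+2*sucj : ∀ i j → i + 2 * suc j ≡ 2 + (i + 2 * j)
i+2*sucj = ℕ-Solver.solve-∀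

∈-triples₀ : ∀ i j → (i , j , 0) ∈ triples₀ (i + 2 * j)
∈-triples₀ 0             zero    = here refl
∈-triples₀ 1             zero    = here refl
∈-triples₀ (suc (suc i)) zero    rewrite +-identityʳ i = here refl
∈-triples₀ i             (suc j) rewrite i+2*sucj i j = there (∈-map⁺ sucⱼ (∈-triples₀ i j))

triples₀⊆triples : ∀ m → triples₀ m ⊆ triples m
triples₀⊆triples 0                   t∈ = t∈
triples₀⊆triples 1                   t∈ = t∈
triples₀⊆triples 2                   t∈ = t∈
triples₀⊆triples (suc (suc (suc m))) t∈ = ∈-++⁺ˡ t∈

∈-triples : ∀ i j k → (i , j , k) ∈ triples (N (i , j , k))
∈-triples i j zero    rewrite +-identityʳ (i + 2 * j) = triples₀⊆triples _ (∈-triples₀ i j)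
∈-triples i j (suc k) = subst (λ m → (i , j , suc k) ∈ triples m) (sym (N-sucₖ (i , j , k)))
  (∈-++⁺ʳ (triples₀ (3 + N (i , j , k))) (∈-map⁺ sucₖ (∈-triples i j k)))

total-triples-3+ : ∀ φ m → total φ (triples (3 + m)) ≡
  total φ (triples₀ (3 + m)) ℤ.+ total (φ ∘ sucₖ) (triples m)
total-triples-3+ φ m = trans (total-++ φ (triples₀ (3 + m)) (map sucₖ (triples m)))
  (+-congˡ (total φ (triples₀ (3 + m))) (total-map φ sucₖ (triples m)))

total₀-k≡0 : ∀ φ → (∀ i j → φ (i , j , 0) ≡ 0ℤ) → ∀ m → total φ (triples₀ m) ≡ 0ℤ
total₀-k≡0 φ φ₀ m = total-0 (All.map (λ { {i , j , _} refl → φ₀ i j }) (triples₀-k m))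

-- The hypothesis on `φ` holds for a summand multiplied by 1 - q⁶ᵏ; `total-sucᵢ` and `total-sucⱼ`
-- serve 1 - qⁱ and 1 - q⁴ʲ in the same way. The shift by 3 is the change of N.
total-sucₖ : ∀ φ → (∀ i j → φ (i , j , 0) ≡ 0ℤ) → ∀ m →
  total φ (triples m) ≡ (q^ 3 ∗ λ m → total (φ ∘ sucₖ) (triples m)) m
total-sucₖ φ φ₀ 0 = total₀-k≡0 φ φ₀ 0
total-sucₖ φ φ₀ 1 = total₀-k≡0 φ φ₀ 1
total-sucₖ φ φ₀ 2 = total₀-k≡0 φ φ₀ 2
total-sucₖ φ φ₀ (suc (suc (suc m))) = trans (total-triples-3+ φ m)
  (trans (cong (ℤ._+ total (φ ∘ sucₖ) (triples m)) (total₀-k≡0 φ φ₀ (3 + m))) (ℤ.+-identityˡ _))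

total-triples₀-2+ : ∀ φ m → total φ (triples₀ (2 + m)) ≡
  φ (2 + m , 0 , 0) ℤ.+ total (φ ∘ sucⱼ) (triples₀ m)
total-triples₀-2+ φ m = +-congˡ (φ (2 + m , 0 , 0)) (total-map φ sucⱼ (triples₀ m))

total₀-sucᵢ : ∀ φ → (∀ j k → φ (0 , j , k) ≡ 0ℤ) → ∀ m →
  total φ (triples₀ (suc m)) ≡ total (φ ∘ sucᵢ) (triples₀ m)
total₀-sucᵢ φ φ₀ 0 = refl
total₀-sucᵢ φ φ₀ 1 = cong (λ c → φ (2 , 0 , 0) ℤ.+ (c ℤ.+ 0ℤ)) (φ₀ 1 0)
total₀-sucᵢ φ φ₀ (suc (suc m)) = begin
  total φ (triples₀ (3 + m))
    ≡⟨ total-triples₀-2+ φ (1 + m) ⟩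
  φ (3 + m , 0 , 0) ℤ.+ total (φ ∘ sucⱼ) (triples₀ (1 + m))
    ≡⟨ +-congˡ (φ (3 + m , 0 , 0)) (total₀-sucᵢ (φ ∘ sucⱼ) (λ j → φ₀ (suc j)) m) ⟩
  φ (3 + m , 0 , 0) ℤ.+ total (φ ∘ sucⱼ ∘ sucᵢ) (triples₀ m)
    ≡⟨ total-triples₀-2+ (φ ∘ sucᵢ) m ⟨
  total (φ ∘ sucᵢ) (triples₀ (2 + m)) ∎
  where open ≡-Reasoning

total-sucᵢ : ∀ φ → (∀ j k → φ (0 , j , k) ≡ 0ℤ) → ∀ m →
  total φ (triples m) ≡ (q^ 1 ∗ λ m → total (φ ∘ sucᵢ) (triples m)) m
total-sucᵢ φ φ₀ 0 = cong (ℤ._+ 0ℤ) (φ₀ 0 0)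
total-sucᵢ φ φ₀ 1 = total₀-sucᵢ φ φ₀ 0
total-sucᵢ φ φ₀ 2 = total₀-sucᵢ φ φ₀ 1
-- The only triple here with positive k is (0 , 0 , 1), which has i = 0.
total-sucᵢ φ φ₀ 3 = trans (total-triples-3+ φ 0)
  (trans (cong₂ ℤ._+_ (total₀-sucᵢ φ φ₀ 2) (cong (ℤ._+ 0ℤ) (φ₀ 0 1))) (ℤ.+-identityʳ _))
total-sucᵢ φ φ₀ (suc (suc (suc (suc m)))) = begin
  total φ (triples (4 + m))
    ≡⟨ total-triples-3+ φ (1 + m) ⟩
  total φ (triples₀ (4 + m)) ℤ.+ total (φ ∘ sucₖ) (triples (1 + m))
    ≡⟨ cong₂ ℤ._+_ (total₀-sucᵢ φ φ₀ (3 + m)) (total-sucᵢ (φ ∘ sucₖ) (λ j k → φ₀ j (suc k)) (suc m)) ⟩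
  total (φ ∘ sucᵢ) (triples₀ (3 + m)) ℤ.+ total (φ ∘ sucₖ ∘ sucᵢ) (triples m)
    ≡⟨ total-triples-3+ (φ ∘ sucᵢ) m ⟨
  total (φ ∘ sucᵢ) (triples (3 + m)) ∎
  where open ≡-Reasoning

total₀-sucⱼ : ∀ φ → (∀ i k → φ (i , 0 , k) ≡ 0ℤ) → ∀ m →
  total φ (triples₀ (2 + m)) ≡ total (φ ∘ sucⱼ) (triples₀ m)
total₀-sucⱼ φ φ₀ m = trans (total-triples₀-2+ φ m)
  (trans (cong (ℤ._+ total (φ ∘ sucⱼ) (triples₀ m)) (φ₀ (2 + m) 0)) (ℤ.+-identityˡ _))

total-sucⱼ : ∀ φ → (∀ i k → φ (i , 0 , k) ≡ 0ℤ) → ∀ m →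
  total φ (triples m) ≡ (q^ 2 ∗ λ m → total (φ ∘ sucⱼ) (triples m)) m
total-sucⱼ φ φ₀ 0 = cong (ℤ._+ 0ℤ) (φ₀ 0 0)
total-sucⱼ φ φ₀ 1 = cong (ℤ._+ 0ℤ) (φ₀ 1 0)
total-sucⱼ φ φ₀ 2 = total₀-sucⱼ φ φ₀ 0
total-sucⱼ φ φ₀ 3 = trans (total-triples-3+ φ 0)
  (trans (cong₂ ℤ._+_ (total₀-sucⱼ φ φ₀ 1) (cong (ℤ._+ 0ℤ) (φ₀ 0 1))) (ℤ.+-identityʳ _))
total-sucⱼ φ φ₀ 4 = trans (total-triples-3+ φ 1)
  (trans (cong₂ ℤ._+_ (total₀-sucⱼ φ φ₀ 2) (cong (ℤ._+ 0ℤ) (φ₀ 1 1))) (ℤ.+-identityʳ _))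
total-sucⱼ φ φ₀ (suc (suc (suc (suc (suc m))))) = begin
  total φ (triples (5 + m))
    ≡⟨ total-triples-3+ φ (2 + m) ⟩
  total φ (triples₀ (5 + m)) ℤ.+ total (φ ∘ sucₖ) (triples (2 + m))
    ≡⟨ cong₂ ℤ._+_ (total₀-sucⱼ φ φ₀ (3 + m)) (total-sucⱼ (φ ∘ sucₖ) (λ i k → φ₀ i (suc k)) (suc (suc m))) ⟩
  total (φ ∘ sucⱼ) (triples₀ (3 + m)) ℤ.+ total (φ ∘ sucₖ ∘ sucⱼ) (triples m)
    ≡⟨ total-triples-3+ (φ ∘ sucⱼ) m ⟨
  total (φ ∘ sucⱼ) (triples (3 + m)) ∎
  where open ≡-Reasoning

-- The triple series

coefficient : ℕ × ℕ × ℕ → QSeries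
coefficient t@(_ , _ , k) n = (-1ℤ ℤ.^ k) ℤ.* inverse (denominator t) n

falling₂ : ℕ → ℕ
falling₂ n = n * (n ∸ 1)

falling₂-suc : ∀ n → falling₂ (suc n) ≡ falling₂ n + 2 * n
falling₂-suc zero    = refl
falling₂-suc (suc n) = lemma n
  where
  lemma : ∀ n → (2 + n) * (1 + n) ≡ (1 + n) * n + 2 * (1 + n)
  lemma = ℕ-Solver.solve-∀

-- The parameter `e` contributes e N, the effect of replacing x by xqᵉ.
linear : (e a b c : ℕ) → ℕ × ℕ × ℕ → ℕ
linear e a b c (i , j , k) = (a + e) * i + (b + 2 * e) * j + (c + 3 * e) * k + 3 * (k * k)

power : (e a b c : ℕ) → ℕ × ℕ × ℕ → ℕ
power e a b c t = falling₂ (N t) + linear e a b c t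

term : (e a b c : ℕ) → ℕ × ℕ × ℕ → QSeries
term e a b c t = q^ power e a b c t ∗ coefficient t

series : (ℕ × ℕ × ℕ → QSeries) → XQSeries
series φ m n = total (λ t → φ t n) (triples m)

-- With H(x) = ∑ (-1)ᵏ x^N q^(N(N-1)+3k²+ai+bj+ck) / ((q;q)ᵢ (q⁴;q⁴)ⱼ (q⁶;q⁶)ₖ), this is H(xqᵉ).
h : (e a b c : ℕ) → XQSeries
h e a b c = series (term e a b c)

-- Raising N by one adds 2N to N(N-1), which amounts to replacing x by xq²; hence the shift of `e`
-- by 2. As j and k weigh 2 and 3 in N, `sucⱼ` and `sucₖ` shift `e` by 4 and 6.
power-sucᵢ : ∀ e a b c t → power e a b c (sucᵢ t) ≡ (a + e) + power (2 + e) a b c t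
power-sucᵢ e a b c t@(i , j , k) =
  trans (cong (_+ linear e a b c (sucᵢ t)) (falling₂-suc (N t)))
    (lemma (falling₂ (N t)) e a b c i j k)
  where
  lemma : ∀ p e a b c i j k →
    p + 2 * (i + 2 * j + 3 * k) + ((a + e) * suc i + (b + 2 * e) * j + (c + 3 * e) * k + 3 * (k * k)) ≡
    (a + e) + (p + ((a + (2 + e)) * i + (b + 2 * (2 + e)) * j + (c + 3 * (2 + e)) * k + 3 * (k * k)))
  lemma = ℕ-Solver.solve-∀

power-sucⱼ : ∀ e a b c t → power e a b c (sucⱼ t) ≡ (2 + b + 2 * e) + power (4 + e) a b c t
power-sucⱼ e a b c t@(i , j , k) =
  trans (cong (_+ linear e a b c (sucⱼ t))
          (trans (cong falling₂ (N-sucⱼ t))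
          (trans (falling₂-suc (1 + N t)) (cong (_+ 2 * (1 + N t)) (falling₂-suc (N t))))))
    (lemma (falling₂ (N t)) e a b c i j k)
  where
  lemma : ∀ p e a b c i j k →
    p + 2 * (i + 2 * j + 3 * k) + 2 * (1 + (i + 2 * j + 3 * k)) +
      ((a + e) * i + (b + 2 * e) * suc j + (c + 3 * e) * k + 3 * (k * k)) ≡
    (2 + b + 2 * e) + (p + ((a + (4 + e)) * i + (b + 2 * (4 + e)) * j + (c + 3 * (4 + e)) * k + 3 * (k * k)))
  lemma = ℕ-Solver.solve-∀

-- The 6 added to `c` comes from 3(k+1)² - 3k² = 6k + 3. The 9 is this 3 plus the 6 in (N+3)(N+2) =
-- N(N-1) + 6N + 6.
power-sucₖ : ∀ e a b c t → power e a b c (sucₖ t) ≡ (9 + c + 3 * e) + power (6 + e) a b (6 + c) t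
power-sucₖ e a b c t@(i , j , k) =
  trans (cong (_+ linear e a b c (sucₖ t))
          (trans (cong falling₂ (N-sucₖ t))
          (trans (falling₂-suc (2 + N t)) (cong (_+ 2 * (2 + N t))
          (trans (falling₂-suc (1 + N t)) (cong (_+ 2 * (1 + N t)) (falling₂-suc (N t))))))))
    (lemma (falling₂ (N t)) e a b c i j k)
  where
  lemma : ∀ p e a b c i j k →
    p + 2 * (i + 2 * j + 3 * k) + 2 * (1 + (i + 2 * j + 3 * k)) + 2 * (2 + (i + 2 * j + 3 * k)) +
      ((a + e) * i + (b + 2 * e) * j + (c + 3 * e) * suc k + 3 * (suc k * suc k)) ≡
    (9 + c + 3 * e) + (p + ((a + (6 + e)) * i + (b + 2 * (6 + e)) * j + (6 + c + 3 * (6 + e)) * k + 3 * (k * k)))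
  lemma = ℕ-Solver.solve-∀

power-1+a : ∀ e a b c i j k → let t = i , j , k in power e (1 + a) b c t ≡ power e a b c t + 1 * i
power-1+a e a b c i j k = lemma (falling₂ (N (i , j , k))) e a b c i j k
  where
  lemma : ∀ p e a b c i j k →
    p + ((1 + a + e) * i + (b + 2 * e) * j + (c + 3 * e) * k + 3 * (k * k)) ≡
    p + ((a + e) * i + (b + 2 * e) * j + (c + 3 * e) * k + 3 * (k * k)) + 1 * i
  lemma = ℕ-Solver.solve-∀

power-4+b : ∀ e a b c i j k → let t = i , j , k in power e a (4 + b) c t ≡ power e a b c t + 4 * j
power-4+b e a b c i j k = lemma (falling₂ (N (i , j , k))) e a b c i j k
  where
  lemma : ∀ p e a b c i j k →
    p + ((a + e) * i + (4 + b + 2 * e) * j + (c + 3 * e) * k + 3 * (k * k)) ≡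
    p + ((a + e) * i + (b + 2 * e) * j + (c + 3 * e) * k + 3 * (k * k)) + 4 * j
  lemma = ℕ-Solver.solve-∀

power-6+c : ∀ e a b c i j k → let t = i , j , k in power e a b (6 + c) t ≡ power e a b c t + 6 * k
power-6+c e a b c i j k = lemma (falling₂ (N (i , j , k))) e a b c i j k
  where
  lemma : ∀ p e a b c i j k →
    p + ((a + e) * i + (b + 2 * e) * j + (6 + c + 3 * e) * k + 3 * (k * k)) ≡
    p + ((a + e) * i + (b + 2 * e) * j + (c + 3 * e) * k + 3 * (k * k)) + 6 * k
  lemma = ℕ-Solver.solve-∀

coefficient-cancel : ∀ c s n t t′ → denominator t′ ≈ denominator t · factor s n → ∀ k →
  c ℤ.* inverse (denominator t′) k ℤ.- (q^ (s * suc n) ∗ λ k → c ℤ.* inverse (denominator t′) k) k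
  ≡ c ℤ.* inverse (denominator t) k
coefficient-cancel c s n t t′ p k = begin
  c ℤ.* f k ℤ.- (q^ g ∗ λ k → c ℤ.* f k) k
    ≡⟨ cong (λ z → c ℤ.* f k ℤ.- z) (q∗-map₂ (λ _ y → c ℤ.* y) (ℤ.*-zeroʳ c) g f f k) ⟩
  c ℤ.* f k ℤ.- c ℤ.* (q^ g ∗ f) k
    ≡⟨ lemma c (f k) ((q^ g ∗ f) k) ⟩
  c ℤ.* (f k ℤ.- (q^ g ∗ f) k)
    ≡⟨ cong (c ℤ.*_) (inverse-cancel-q s n t t′ p k) ⟩
  c ℤ.* inverse (denominator t) k ∎
  where
  open ≡-Reasoning
  f = inverse (denominator t′)
  g = s * suc n
  lemma : ∀ c x y → c ℤ.* x ℤ.- c ℤ.* y ≡ c ℤ.* (x ℤ.- y)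
  lemma = ℤ-Solver.solve-∀

-- The operation is subtraction for i and j, and flipped subtraction for k, where the sign (-1)ᵏ
-- reverses the difference.
q∗-telescope : ∀ (_⊕_ : ℤ → ℤ → ℤ) → 0ℤ ⊕ 0ℤ ≡ 0ℤ → ∀ {p p′ p″ g} d f f′ →
  p′ ≡ p + g → p ≡ d + p″ → (∀ n → f n ⊕ (q^ g ∗ f) n ≡ f′ n) →
  ∀ n → (q^ p ∗ f) n ⊕ (q^ p′ ∗ f) n ≡ (q^ d ∗ q^ p″ ∗ f′) n
q∗-telescope _⊕_ z {p} {p′} {p″} {g} d f f′ p′≡ p≡ cancel n = begin
  (q^ p ∗ f) n ⊕ (q^ p′ ∗ f) n         ≡⟨ cong (λ p′ → (q^ p ∗ f) n ⊕ (q^ p′ ∗ f) n) p′≡ ⟩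
  (q^ p ∗ f) n ⊕ (q^ (p + g) ∗ f) n    ≡⟨ cong ((q^ p ∗ f) n ⊕_) (q∗-+ p g f n) ⟨
  (q^ p ∗ f) n ⊕ (q^ p ∗ q^ g ∗ f) n   ≡⟨ q∗-map₂ _⊕_ z p f (q^ g ∗ f) n ⟨
  (q^ p ∗ λ n → f n ⊕ (q^ g ∗ f) n) n  ≡⟨ q∗-cong p cancel n ⟩
  (q^ p ∗ f′) n                        ≡⟨ cong (λ p → (q^ p ∗ f′) n) p≡ ⟩
  (q^ (d + p″) ∗ f′) n                 ≡⟨ q∗-+ d p″ f′ n ⟨
  (q^ d ∗ q^ p″ ∗ f′) n                ∎
  where open ≡-Reasoning

series-difference : ∀ d e (σ : ℕ × ℕ × ℕ → ℕ × ℕ × ℕ) φ ψ χ →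
  (∀ n m → total (λ t → φ t n ℤ.- ψ t n) (triples m) ≡
           (q^ d ∗ λ m → total (λ t → φ (σ t) n ℤ.- ψ (σ t) n) (triples m)) m) →
  (∀ t → φ (σ t) - ψ (σ t) ≈ q^ e ∗ χ t) →
  ∀ m n → series φ m n ≡ series ψ m n ℤ.+ (x^ d q^ e ∗ series χ) m n
series-difference d e σ φ ψ χ shift step m n =
  trans (lemma (series φ m n) (series ψ m n)) (+-congˡ (series ψ m n) (begin
    series φ m n ℤ.- series ψ m n
      ≡⟨ total-- (λ t → φ t n) (λ t → ψ t n) (triples m) ⟨
    total (λ t → φ t n ℤ.- ψ t n) (triples m)
      ≡⟨ shift n m ⟩
    (q^ d ∗ λ m → total (λ t → φ (σ t) n ℤ.- ψ (σ t) n) (triples m)) m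
      ≡⟨ q∗-cong d (λ m → trans (total-cong (All.universal (λ t → step t n) (triples m)))
                                (q∗-total e χ (triples m) n)) m ⟩
    (x^ d q^ e ∗ series χ) m n ∎))
  where
  open ≡-Reasoning
  lemma : ∀ x y → x ≡ y ℤ.+ (x ℤ.- y)
  lemma = ℤ-Solver.solve-∀

term-unchanged : ∀ {p p′} f n → p′ ≡ p + 0 → (q^ p ∗ f) n ℤ.- (q^ p′ ∗ f) n ≡ 0ℤ
term-unchanged {p} f n refl = trans (cong (λ p′ → (q^ p ∗ f) n ℤ.- (q^ p′ ∗ f) n) (+-identityʳ p))
  (ℤ.+-inverseʳ ((q^ p ∗ f) n))

h-1+a : ∀ e a b c m n →
  h e a b c m n ≡ h e (1 + a) b c m n ℤ.+ (x^ 1 q^ (a + e) ∗ h (2 + e) a b c) m n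
h-1+a e a b c = series-difference 1 (a + e) sucᵢ (term e a b c) (term e (1 + a) b c) (term (2 + e) a b c)
  (λ n → total-sucᵢ _ λ j k → term-unchanged (coefficient (0 , j , k)) n (power-1+a e a b c 0 j k))
  λ t@(i , j , k) → q∗-telescope ℤ._-_ refl (a + e) (coefficient (sucᵢ t)) (coefficient t)
    (power-1+a e a b c (suc i) j k) (power-sucᵢ e a b c t)
    (coefficient-cancel (-1ℤ ℤ.^ k) 1 i t (sucᵢ t) (denominator-sucᵢ i j k))

h-4+b : ∀ e a b c m n →
  h e a b c m n ≡ h e a (4 + b) c m n ℤ.+ (x^ 2 q^ (2 + b + 2 * e) ∗ h (4 + e) a b c) m n
h-4+b e a b c = series-difference 2 (2 + b + 2 * e) sucⱼ
  (term e a b c) (term e a (4 + b) c) (term (4 + e) a b c)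
  (λ n → total-sucⱼ _ λ i k → term-unchanged (coefficient (i , 0 , k)) n (power-4+b e a b c i 0 k))
  λ t@(i , j , k) → q∗-telescope ℤ._-_ refl (2 + b + 2 * e) (coefficient (sucⱼ t)) (coefficient t)
    (power-4+b e a b c i (suc j) k) (power-sucⱼ e a b c t)
    (coefficient-cancel (-1ℤ ℤ.^ k) 4 j t (sucⱼ t) (denominator-sucⱼ i j k))

-- The sign (-1)ᵏ exchanges the roles of the two series.
h-6+c : ∀ e a b c m n →
  h e a b (6 + c) m n ≡ h e a b c m n ℤ.+ (x^ 3 q^ (9 + c + 3 * e) ∗ h (6 + e) a b (6 + c)) m n
h-6+c e a b c = series-difference 3 (9 + c + 3 * e) sucₖ
  (term e a b (6 + c)) (term e a b c) (term (6 + e) a b (6 + c))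
  (λ n → total-sucₖ _ λ i j → trans (swap (term e a b (6 + c) (i , j , 0) n) (term e a b c (i , j , 0) n))
    (cong ℤ.-_ (term-unchanged (coefficient (i , j , 0)) n (power-6+c e a b c i j 0))))
  λ t@(i , j , k) → q∗-telescope (flip ℤ._-_) refl (9 + c + 3 * e) (coefficient (sucₖ t)) (coefficient t)
    (power-6+c e a b c i j (suc k)) (power-sucₖ e a b c t)
    λ n → trans (swap ((q^ (6 * suc k) ∗ coefficient (sucₖ t)) n) (coefficient (sucₖ t) n))
      (trans (cong ℤ.-_ (coefficient-cancel (-1ℤ ℤ.^ suc k) 6 k t (sucₖ t) (denominator-sucₖ i j k) n))
        (negate (-1ℤ ℤ.^ k) (inverse (denominator t) n)))
  where
  swap : ∀ x y → x ℤ.- y ≡ ℤ.- (y ℤ.- x)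
  swap = ℤ-Solver.solve-∀
  negate : ∀ c x → ℤ.- ((-1ℤ ℤ.* c) ℤ.* x) ≡ c ℤ.* x
  negate = ℤ-Solver.solve-∀

-- Since N = i + 2j + 3k, replacing x by xq² adds 2i + 4j + 6k to the exponent.
h-2+e : ∀ e a b c m n → h e (2 + a) (4 + b) (6 + c) m n ≡ h (2 + e) a b c m n
h-2+e e a b c m n = total-cong (All.universal
  (λ t@(i , j , k) → cong (λ p → (q^ p ∗ coefficient t) n) (lemma (falling₂ (N t)) e a b c i j k)) (triples m))
  where
  lemma : ∀ p e a b c i j k →
    p + ((2 + a + e) * i + (4 + b + 2 * e) * j + (6 + c + 3 * e) * k + 3 * (k * k)) ≡
    p + ((a + (2 + e)) * i + (b + 2 * (2 + e)) * j + (c + 3 * (2 + e)) * k + 3 * (k * k))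
  lemma = ℕ-Solver.solve-∀

x∗-+-≡ : ∀ d e d′ e′ {e″} → e + e′ ≡ e″ → ∀ F m n →
         (x^ d q^ e ∗ x^ d′ q^ e′ ∗ F) m n ≡ (x^ (d + d′) q^ e″ ∗ F) m n
x∗-+-≡ d e d′ e′ refl = x∗-+ d e d′ e′

infixl 6 _⊞_

_⊞_ : XQSeries → XQSeries → XQSeries
(F ⊞ G) m n = F m n ℤ.+ G m n

x∗-⊞ : ∀ d e F G m n → (x^ d q^ e ∗ (F ⊞ G)) m n ≡ (x^ d q^ e ∗ F) m n ℤ.+ (x^ d q^ e ∗ G) m n
x∗-⊞ = x∗-map₂ ℤ._+_ refl

-- The functional equations

-- F e and G e are F(xqᵉ) and G(xqᵉ). For even e they count the partitions in 𝒫 with all parts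
-- > e and > 1 + e, respectively; K e counts those which may follow the part 1 + e.
F G K : ℕ → XQSeries
F e = h e 1 0 0
G e = h e 2 4 6
K e = G (2 + e) ⊞ (x^ 1 q^ (1 + e) ∗ F (4 + e) ⊞ x^ 1 q^ (3 + e) ∗ G (4 + e))

-- The factor 1 - qⁱ leads from (2,4,6) to (3,4,6), which is (1,0,0) with xq² for x.
G-equation : ∀ e m n → G e m n ≡ (F (2 + e) ⊞ x^ 1 q^ (2 + e) ∗ G (2 + e)) m n
G-equation e m n = trans (h-1+a e 2 4 6 m n)
  (cong (ℤ._+ (x^ 1 q^ (2 + e) ∗ G (2 + e)) m n) (h-2+e e 1 0 0 m n))

x∗-K : ∀ d p e {p₁ p₃} → p + (1 + e) ≡ p₁ → p + (3 + e) ≡ p₃ → ∀ m n → (x^ d q^ p ∗ K e) m n ≡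
  (x^ d q^ p ∗ G (2 + e) ⊞ (x^ (d + 1) q^ p₁ ∗ F (4 + e) ⊞ x^ (d + 1) q^ p₃ ∗ G (4 + e))) m n
x∗-K d p e p₁≡ p₃≡ m n = trans (x∗-⊞ d p (G (2 + e)) _ m n)
  (+-congˡ ((x^ d q^ p ∗ G (2 + e)) m n)
    (trans (x∗-⊞ d p (x^ 1 q^ (1 + e) ∗ F (4 + e)) (x^ 1 q^ (3 + e) ∗ G (4 + e)) m n)
      (cong₂ ℤ._+_ (x∗-+-≡ d p 1 (1 + e) p₁≡ (F (4 + e)) m n)
                   (x∗-+-≡ d p 1 (3 + e) p₃≡ (G (4 + e)) m n))))

defect : ℕ → XQSeries
defect e m n = F e m n ℤ.- (G e ⊞ x^ 1 q^ (1 + e) ∗ K e) m n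

-- F descends through (2,0,0) to (2,4,0), and G is reduced to the same `B₀` by the factor 1 - q⁶ᵏ.
-- Expanding the `F (4 + e)` inside `K e` once more produces a second `x²A`, which cancels the one
-- left by the factor 1 - q⁴ʲ. The remaining terms regroup into the defect at `2 + e`.
defect-step : ∀ e m n → defect e m n ≡ (x^ 1 q^ (1 + e) ∗ defect (2 + e)) m n
defect-step e m n = begin
  defect e m n
    ≡⟨ cong₂ ℤ._-_
         (trans (h-1+a e 1 0 0 m n) (cong (ℤ._+ XF) (h-4+b e 2 0 0 m n)))
         (cong₂ ℤ._+_ (h-6+c e 2 4 0 m n)
           (trans (x∗-K 1 (1 + e) e (eq₁ e) (eq₂ e) m n)
             (cong (λ z → XG ℤ.+ (z ℤ.+ x²G))
               (trans (x∗-cong 2 (2 + 2 * e) (h-1+a (4 + e) 1 0 0) m n)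
               (trans (x∗-⊞ 2 (2 + 2 * e) (h (4 + e) 2 0 0) _ m n)
                 (+-congˡ x²A (x∗-+-≡ 2 (2 + 2 * e) 1 (5 + e) (eq₃ e) (F (6 + e)) m n))))))) ⟩
  (B₀ ℤ.+ x²A ℤ.+ XF) ℤ.- (B₀ ℤ.+ x³G ℤ.+ (XG ℤ.+ (x²A ℤ.+ x³F ℤ.+ x²G)))
    ≡⟨ lemma B₀ x²A XF x³G XG x³F x²G ⟩
  XF ℤ.- (XG ℤ.+ (x²G ℤ.+ (x³F ℤ.+ x³G)))
    ≡⟨ cong (λ z → XF ℤ.- (XG ℤ.+ z)) (x∗-K 2 (4 + 2 * e) (2 + e) (eq₄ e) (eq₅ e) m n) ⟨
  XF ℤ.- (XG ℤ.+ (x^ 2 q^ (4 + 2 * e) ∗ K (2 + e)) m n)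
    ≡⟨ cong (λ z → XF ℤ.- (XG ℤ.+ z)) (x∗-+-≡ 1 (1 + e) 1 (3 + e) (eq₂ e) (K (2 + e)) m n) ⟨
  XF ℤ.- (XG ℤ.+ (x^ 1 q^ (1 + e) ∗ x^ 1 q^ (3 + e) ∗ K (2 + e)) m n)
    ≡⟨ cong (λ z → XF ℤ.- z) (x∗-⊞ 1 (1 + e) (G (2 + e)) (x^ 1 q^ (3 + e) ∗ K (2 + e)) m n) ⟨
  XF ℤ.- (x^ 1 q^ (1 + e) ∗ (G (2 + e) ⊞ x^ 1 q^ (3 + e) ∗ K (2 + e))) m n
    ≡⟨ x∗-map₂ ℤ._-_ refl 1 (1 + e) (F (2 + e)) (G (2 + e) ⊞ x^ 1 q^ (3 + e) ∗ K (2 + e)) m n ⟨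
  (x^ 1 q^ (1 + e) ∗ defect (2 + e)) m n ∎
  where
  open ≡-Reasoning
  B₀ = h e 2 4 0 m n
  XF = (x^ 1 q^ (1 + e) ∗ F (2 + e)) m n
  XG = (x^ 1 q^ (1 + e) ∗ G (2 + e)) m n
  x²A = (x^ 2 q^ (2 + 2 * e) ∗ h (4 + e) 2 0 0) m n
  x²G = (x^ 2 q^ (4 + 2 * e) ∗ G (4 + e)) m n
  x³F = (x^ 3 q^ (7 + 3 * e) ∗ F (6 + e)) m n
  x³G = (x^ 3 q^ (9 + 3 * e) ∗ G (6 + e)) m n
  eq₁ : ∀ e → (1 + e) + (1 + e) ≡ 2 + 2 * e
  eq₁ = ℕ-Solver.solve-∀
  eq₂ : ∀ e → (1 + e) + (3 + e) ≡ 4 + 2 * e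
  eq₂ = ℕ-Solver.solve-∀
  eq₃ : ∀ e → (2 + 2 * e) + (5 + e) ≡ 7 + 3 * e
  eq₃ = ℕ-Solver.solve-∀
  eq₄ : ∀ e → (4 + 2 * e) + (3 + e) ≡ 7 + 3 * e
  eq₄ = ℕ-Solver.solve-∀
  eq₅ : ∀ e → (4 + 2 * e) + (5 + e) ≡ 9 + 3 * e
  eq₅ = ℕ-Solver.solve-∀
  lemma : ∀ b a f g G f′ G′ →
    (b ℤ.+ a ℤ.+ f) ℤ.- (b ℤ.+ g ℤ.+ (G ℤ.+ (a ℤ.+ f′ ℤ.+ G′))) ≡ f ℤ.- (G ℤ.+ (G′ ℤ.+ (f′ ℤ.+ g)))
  lemma = ℤ-Solver.solve-∀

-- Each step lowers the power of x by one while `e` grows, so the induction on `m` is uniform in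
-- `e`. At x⁰ the right side of `defect-step` is zero by definition.
defect≡0 : ∀ m e n → defect e m n ≡ 0ℤ
defect≡0 zero    e n = defect-step e zero n
defect≡0 (suc m) e n = trans (defect-step e (suc m) n)
  (trans (q∗-cong (1 + e) (defect≡0 m (2 + e)) n) (q∗-0 (1 + e) n))

F-equation : ∀ e m n → F e m n ≡ (G e ⊞ x^ 1 q^ (1 + e) ∗ K e) m n
F-equation e m n = ℤ.i-j≡0⇒i≡j _ _ (defect≡0 m e n)

-- Low-order coefficients

-- The terms of the exponent that contain `e` add up to e N. For N ≥ 1 every summand therefore
-- starts at qᵉ or later, and for N = 0 the single triple contributes 1.
h-low : ∀ e a b c m n → n < e → h e a b c m n ≡ weight [] m n
h-low e a b c zero n n<e = trans (ℤ.+-identityʳ _) (trans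
  (cong (λ p → (q^ p ∗ coefficient (0 , 0 , 0)) n) (lemma e a b c))
  (trans (ℤ.*-identityˡ _) (sym (inverse-unique (𝟙 · 𝟙 · 𝟙) 𝟙 refl
    (·-𝟙 (·-𝟙 (·-𝟙 {𝟙} λ _ → refl))) n))))
  where
  ·-𝟙 : ∀ {f} → f ≈ 𝟙 → f · 𝟙 ≈ 𝟙
  ·-𝟙 p n = trans (·-congʳ 𝟙 p n) (·-identityˡ 𝟙 n)
  lemma : ∀ e a b c → (a + e) * 0 + (b + 2 * e) * 0 + (c + 3 * e) * 0 + 0 ≡ 0
  lemma = ℕ-Solver.solve-∀
h-low e a b c (suc m) n n<e = total-0 (All.map
  (λ {t} N≡ → q∗-< (power e a b c t) (coefficient t) (<-≤-trans n<e (e≤power t N≡)))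
  (triples-N (suc m)))
  where
  lemma : ∀ p e a b c i j k →
    p + ((a + e) * i + (b + 2 * e) * j + (c + 3 * e) * k + 3 * (k * k)) ≡
    p + a * i + b * j + c * k + 3 * (k * k) + e * (i + 2 * j + 3 * k)
  lemma = ℕ-Solver.solve-∀
  e≤power : ∀ t → N t ≡ suc m → e ≤ power e a b c t
  e≤power t@(i , j , k) N≡ = begin
    e             ≤⟨ m≤m*n e (suc m) ⟩
    e * suc m     ≡⟨ cong (e *_) N≡ ⟨
    e * N t       ≤⟨ m≤n+m (e * N t) _ ⟩
    _ + e * N t   ≡⟨ lemma (falling₂ (N t)) e a b c i j k ⟨
    power e a b c t ∎
    where open ≤-Reasoning

-- Enumeration of partitions

-- For even e, the members of listF d e, listG d e and listK d e are counted by F e, G e and K e.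
-- The fuel d makes listF d e and listG d e complete for partitions of size < e + d, and listK d e
-- for size < 2 + e + d.
listF listG listK : (d e : ℕ) → List (List ℕ)
listF zero    e = [ [] ]
listF (suc d) e = listG (suc d) e ++ map (1 + e ∷_) (listK d e)
listG zero    e = [ [] ]
listG (suc d) e = listF d (2 + e) ++ map (2 + e ∷_) (listG d (2 + e))
listK d e = listG d (2 + e) ++ (map (1 + e ∷_) (listF d (4 + e)) ++ map (3 + e ∷_) (listG d (4 + e)))

weights : List (List ℕ) → XQSeries
weights πs m n = total (λ π → weight π m n) πs

∙q^-+ : ∀ c e e′ → c ∙q^ (e + e′) ≈ q^ e ∗ c ∙q^ e′
∙q^-+ c zero    e′ n       = refl
∙q^-+ c (suc e) e′ zero    = refl
∙q^-+ c (suc e) e′ (suc n) = ∙q^-+ c e e′ n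

weight-∷ : ∀ a π m n → weight (a ∷ π) m n ≡ (x^ 1 q^ a ∗ weight π) m n
weight-∷ a π zero    n = refl
-- The length tests on both sides compute to this boolean.
weight-∷ a π (suc m) n with m ≡ᵇ length π
... | true  = ∙q^-+ 1ℤ a (sum π) n
... | false = sym (q∗-0 a n)

weights-++ : ∀ πs ρs m n → weights (πs ++ ρs) m n ≡ (weights πs ⊞ weights ρs) m n
weights-++ πs ρs m n = total-++ (λ π → weight π m n) πs ρs

weights-∷ : ∀ a πs m n → weights (map (a ∷_) πs) m n ≡ (x^ 1 q^ a ∗ weights πs) m n
weights-∷ a πs m n = begin
  weights (map (a ∷_) πs) m n
    ≡⟨ total-map (λ π → weight π m n) (a ∷_) πs ⟩
  total (λ π → weight (a ∷ π) m n) πs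
    ≡⟨ total-cong (All.universal (λ π → weight-∷ a π m n) πs) ⟩
  total (λ π → (x^ 1 q^ a ∗ weight π) m n) πs
    ≡⟨ q∗-total 1 (λ π m → (q^ a ∗ weight π m) n) πs m ⟩
  (q^ 1 ∗ λ m → total (λ π → (q^ a ∗ weight π m) n) πs) m
    ≡⟨ q∗-cong 1 (λ m → q∗-total a (λ π → weight π m) πs n) m ⟩
  (x^ 1 q^ a ∗ weights πs) m n ∎
  where open ≡-Reasoning

infix 4 _≈_below_

-- Congruence modulo q to the power `b` in each power of x. Multiplication by monomials preserves
-- it, so one bound can be carried through the whole recursion.
_≈_below_ : XQSeries → XQSeries → ℕ → Set
H ≈ H′ below b = ∀ m n → n < b → H m n ≡ H′ m n

q∗-cong-≤ : ∀ e {f g n} → (∀ k → k ≤ n → f k ≡ g k) → (q^ e ∗ f) n ≡ (q^ e ∗ g) n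
q∗-cong-≤ zero            p = p _ ≤-refl
q∗-cong-≤ (suc e) {n = zero}  p = refl
q∗-cong-≤ (suc e) {n = suc n} p = q∗-cong-≤ e λ k k≤n → p k (m≤n⇒m≤1+n k≤n)

below-x∗ : ∀ d e {H H′ b} → H ≈ H′ below b → x^ d q^ e ∗ H ≈ x^ d q^ e ∗ H′ below b
below-x∗ d e p m n n<b =
  q∗-cong d (λ m → q∗-cong-≤ e λ k k≤n → p m k (≤-<-trans k≤n n<b)) m

weights-∷-below : ∀ a πs {H b} → weights πs ≈ H below b →
                  weights (map (a ∷_) πs) ≈ x^ 1 q^ a ∗ H below b
weights-∷-below a πs p m n n<b = trans (weights-∷ a πs m n) (below-x∗ 1 a p m n n<b)

weights-++-below : ∀ πs ρs {H I b} → weights πs ≈ H below b → weights ρs ≈ I below b →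
                   weights (πs ++ ρs) ≈ H ⊞ I below b
weights-++-below πs ρs p r m n n<b =
  trans (weights-++ πs ρs m n) (cong₂ ℤ._+_ (p m n n<b) (r m n n<b))

weights-[] : ∀ e a b c {l} → l ≤ e + 0 → weights [ [] ] ≈ h e a b c below l
weights-[] e a b c l≤ m n n<l = trans (ℤ.+-identityʳ _)
  (sym (h-low e a b c m n (subst (n <_) (+-identityʳ e) (<-≤-trans n<l l≤))))

≤-fuel : ∀ d e {l} → l ≤ e + suc d → l ≤ 2 + e + d
≤-fuel d e l≤ = m≤n⇒m≤1+n (≤-trans l≤ (≤-reflexive (+-suc e d)))

-- The bound `l` stays fixed while the recursion trades one unit of fuel for at least two units of
-- `e`. When the fuel is gone it reads l ≤ e, and below qᵉ the series are 1 by `h-low`, the weight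
-- of the only listed partition.
weights-listF : ∀ d e {l} → l ≤ e + d → weights (listF d e) ≈ F e below l
weights-listG : ∀ d e {l} → l ≤ e + d → weights (listG d e) ≈ G e below l
weights-listK : ∀ d e {l} → l ≤ 2 + e + d → weights (listK d e) ≈ K e below l

weights-listF zero    e l≤ = weights-[] e 1 0 0 l≤
weights-listF (suc d) e l≤ m n n<l = trans
  (weights-++-below (listG (suc d) e) _ (weights-listG (suc d) e l≤)
    (weights-∷-below (1 + e) (listK d e) (weights-listK d e (≤-fuel d e l≤))) m n n<l)
  (sym (F-equation e m n))
weights-listG zero    e l≤ = weights-[] e 2 4 6 l≤
weights-listG (suc d) e l≤ m n n<l = trans
  (weights-++-below (listF d (2 + e)) _ (weights-listF d (2 + e) l≤′)
    (weights-∷-below (2 + e) (listG d (2 + e)) (weights-listG d (2 + e) l≤′)) m n n<l)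
  (sym (G-equation e m n))
  where l≤′ = ≤-fuel d e l≤
weights-listK d e l≤ =
  weights-++-below (listG d (2 + e)) _ (weights-listG d (2 + e) l≤)
    (weights-++-below (map (1 + e ∷_) (listF d (4 + e))) _
      (weights-∷-below (1 + e) (listF d (4 + e)) (weights-listF d (4 + e) l≤′))
      (weights-∷-below (3 + e) (listG d (4 + e)) (weights-listG d (4 + e) l≤′)))
  where l≤′ = m≤n⇒m≤1+n (m≤n⇒m≤1+n l≤)

-- A local description of 𝒫

Odd : ℕ → Set
Odd a = ∃[ j ] a ≡ 2 * j + 1

odd⇒¬even : ∀ {a} → Odd a → ¬ 2 ∣ a
odd⇒¬even (j , refl) 2∣a with () ← ∣1⇒≡1 (∣m+n∣m⇒∣n 2∣a (m∣m*n j))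

even⇒1+odd : ∀ {e} → 2 ∣ e → Odd (1 + e)
even⇒1+odd (divides q refl) = q , trans (+-comm 1 (q * 2)) (cong (_+ 1) (*-comm q 2))

even-2+ : ∀ {e} → 2 ∣ e → 2 ∣ 2 + e
even-2+ = ∣m∣n⇒∣m+n ∣-refl

-- Condition (ii) can be tested on neighbours: in a weakly increasing list, a smallest part that
-- differs from the next part differs from all later ones.
Adjacent : ℕ → ℕ → Set
Adjacent a b = a ≤ b × ∣ a - b ∣ ≢ 1 × (2 ∣ a → a ≢ b)

-- For a ≤ b ≤ c these are exactly the triples excluded by (iii), (iv) and (v), with t eliminated.
data Forbidden (a b c : ℕ) : Set where
  iii : Odd a → a ≡ b → c ≤ 3 + a → Forbidden a b c
  iv  : Odd b → b ≡ c → b ≤ 2 + a → Forbidden a b c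
  v   : Odd a → b ≡ 2 + a → c ≡ 4 + a → Forbidden a b c

𝒫-increasing : ∀ {π} → 𝒫 π → Linked _≤_ π
𝒫-increasing p = IsPartition.increasing (𝒫.isPartition p)

𝒫-[] : 𝒫 []
𝒫-[] = record
  { isPartition = record { positive = [] ; increasing = [] }
  ; i   = []
  ; ii  = []
  ; iii = λ { _ _ _ (here ()) }
  ; iv  = λ { _ _ _ (here ()) }
  ; v   = λ { _ (here ()) }
  }

𝒫-tail : ∀ {a π} → 𝒫 (a ∷ π) → 𝒫 π
𝒫-tail p = record
  { isPartition = record
    { positive   = All.tail (IsPartition.positive (𝒫.isPartition p))
    ; increasing = Linked.tail (𝒫-increasing p)
    }
  ; i   = Linked.tail (𝒫.i p)
  ; ii  = AllPairs.tail (𝒫.ii p)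
  ; iii = λ j t t≤ → 𝒫.iii p j t t≤ ∘ there
  ; iv  = λ j t t≤ → 𝒫.iv p j t t≤ ∘ there
  ; v   = λ j → 𝒫.v p j ∘ there
  }

-- The conditions on `a` are stated through equations for `π`, which makes them vacuous when `π` is
-- too short.
𝒫-∷ : ∀ {a π} → 0 < a → (∀ {b ρ} → π ≡ b ∷ ρ → Adjacent a b) →
      (∀ {b c ρ} → π ≡ b ∷ c ∷ ρ → ¬ Forbidden a b c) → 𝒫 π → 𝒫 (a ∷ π)
𝒫-∷ {a} {π} 0<a adjacent allowed p = record
  { isPartition = record
    { positive   = 0<a ∷ IsPartition.positive (𝒫.isPartition p)
    ; increasing = link (proj₁ ∘ adjacent) (𝒫-increasing p)
    }
  ; i   = link (proj₁ ∘ proj₂ ∘ adjacent) (𝒫.i p)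
  ; ii  = distinct adjacent (𝒫-increasing p) ∷ 𝒫.ii p
  ; iii = λ where
      j t t≤ (here (refl ∷ refl ∷ refl ∷ _)) →
        allowed refl (iii (j , refl) refl
          (≤-trans (+-monoʳ-≤ (2 * j + 1) t≤) (≤-reflexive (+-comm (2 * j + 1) 3))))
      j t t≤ (there q) → 𝒫.iii p j t t≤ q
  ; iv  = λ where
      j t t≤ (here (refl ∷ refl ∷ refl ∷ _)) →
        allowed refl (iv (j , refl) refl (≤-trans (m≤n+m∸n (2 * j + 1) t) (+-monoˡ-≤ _ t≤)))
      j t t≤ (there q) → 𝒫.iv p j t t≤ q
  ; v   = λ where
      j (here (refl ∷ refl ∷ refl ∷ _)) → allowed refl (v (j , refl) (shift j 2) (shift j 4))
      j (there q) → 𝒫.v p j q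
  }
  where
  shift : ∀ j c → 2 * j + (c + 1) ≡ c + (2 * j + 1)
  shift = ℕ-Solver.solve-∀
  link : ∀ {R : ℕ → ℕ → Set} {π} → (∀ {b ρ} → π ≡ b ∷ ρ → R a b) → Linked R π → Linked R (a ∷ π)
  link {π = []}    r l = [-]
  link {π = _ ∷ _} r l = r refl ∷ l
  distinct : ∀ {π} → (∀ {b ρ} → π ≡ b ∷ ρ → Adjacent a b) → Linked _≤_ π → All (λ b → 2 ∣ a → a ≢ b) π
  distinct {[]}    adj l = []
  distinct {b ∷ π} adj l with a≤b , _ , a≢b ← adj refl =
    All.map (λ b≤c 2∣a → <⇒≢ (<-≤-trans (≤∧≢⇒< a≤b (a≢b 2∣a)) b≤c)) (Linked.Linked⇒All ≤-trans ≤-refl l)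

𝒫-adjacent : ∀ {a b π} → 𝒫 (a ∷ b ∷ π) → Adjacent a b
𝒫-adjacent p with (a≢b ∷ _) ∷ _ ← 𝒫.ii p =
  Linked.head (𝒫-increasing p) , Linked.head (𝒫.i p) , a≢b

𝒫-allowed : ∀ {a b c π} → 𝒫 (a ∷ b ∷ c ∷ π) → ¬ Forbidden a b c
𝒫-allowed {a} {b} {c} p (iii (j , refl) refl c≤3+a) =
  -- The eliminated t is recovered as a difference, exact because the parts increase; likewise for
  -- (iv).
  𝒫.iii p j (c ∸ a) (m≤n+o⇒m∸n≤o c a (≤-trans c≤3+a (≤-reflexive (+-comm 3 a))))
    (here (refl ∷ refl ∷ m+[n∸m]≡n (proj₁ (𝒫-adjacent (𝒫-tail p))) ∷ []))
𝒫-allowed {a} {b} p (iv (j , refl) refl b≤2+a) =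
  𝒫.iv p j (b ∸ a) (m≤n+o⇒m∸n≤o b a (≤-trans b≤2+a (≤-reflexive (+-comm 2 a))))
    (here (m∸[m∸n]≡n (proj₁ (𝒫-adjacent p)) ∷ refl ∷ refl ∷ []))
𝒫-allowed p (v (j , refl) refl refl) =
  𝒫.v p j (here (refl ∷ shift j 2 ∷ shift j 4 ∷ []))
  where
  shift : ∀ j c → 2 * j + (c + 1) ≡ c + (2 * j + 1)
  shift = ℕ-Solver.solve-∀

adjacent-far : ∀ {a b} → 1 + a < b → Adjacent a b
adjacent-far {a} {b} 1+a<b = a≤b , (λ ∣a-b∣≡1 → <⇒≢ 1+a<b (begin
    1 + a         ≡⟨ +-comm 1 a ⟩
    a + 1         ≡⟨ cong (a +_) (trans (sym (m≤n⇒∣m-n∣≡n∸m a≤b)) ∣a-b∣≡1) ⟨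
    a + (b ∸ a)   ≡⟨ m+[n∸m]≡n a≤b ⟩
    b             ∎)) , λ _ → <⇒≢ (<-trans (n<1+n a) 1+a<b)
  where
  open ≡-Reasoning
  a≤b = <⇒≤ (<-trans (n<1+n a) 1+a<b)

adjacent⇒far : ∀ {a b} → Adjacent a b → a ≢ b → 1 + a < b
adjacent⇒far {a} (a≤b , gap , _) a≢b = ≤∧≢⇒< (≤∧≢⇒< a≤b a≢b) λ where
  refl → gap (trans (cong ∣ a -_∣ (+-comm 1 a)) (∣m-m+n∣≡n a 1))

-- Extending partitions in 𝒫 by a new smallest part

𝒫-from : ℕ → List ℕ → Set
𝒫-from l π = 𝒫 π × All (l <_) π

weaken : ∀ {l l′ π} → l ≤ l′ → 𝒫-from l′ π → 𝒫-from l π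
weaken l≤l′ (p , l′<) = p , All.map (≤-<-trans l≤l′) l′<

𝒫-from-∷ : ∀ {l a π} → l < a → 𝒫 (a ∷ π) → 𝒫-from l (a ∷ π)
𝒫-from-∷ l<a p = p , All.map (<-≤-trans l<a) (Linked.Linked⇒All ≤-trans ≤-refl (𝒫-increasing p))

-- Only (iv) could involve an even smallest part, and it would force the next part to be 2 + a,
-- which is even, whereas (iv) repeats an odd part.
even-∷ : ∀ {a π} → 0 < a → 2 ∣ a → 𝒫-from (1 + a) π → 𝒫 (a ∷ π)
even-∷ {a} 0<a 2∣a (p , far) = 𝒫-∷ 0<a (λ { refl → adjacent-far (All.head far) }) (λ { refl → allowed far }) p
  where
  allowed : ∀ {b c ρ} → All (1 + a <_) (b ∷ c ∷ ρ) → ¬ Forbidden a b c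
  allowed _          (iii odd _ _)    = odd⇒¬even odd 2∣a
  allowed (1+a<b ∷ _) (iv odd _ b≤2+a) =
    odd⇒¬even odd (subst (2 ∣_) (≤-antisym 1+a<b b≤2+a) (even-2+ 2∣a))
  allowed _          (v odd _ _)      = odd⇒¬even odd 2∣a

-- Every forbidden triple has its second part at most 2 + a.
gap-∷ : ∀ {a π} → 0 < a → 𝒫-from (2 + a) π → 𝒫 (a ∷ π)
gap-∷ {a} 0<a (p , far) =
  𝒫-∷ 0<a (λ { refl → adjacent-far (<⇒≤ (All.head far)) }) (λ { refl → allowed far }) p
  where
  allowed : ∀ {b c ρ} → All (2 + a <_) (b ∷ c ∷ ρ) → ¬ Forbidden a b c
  allowed (2+a<b ∷ _) (iii _ refl _)   = <⇒≱ 2+a<b (m≤n+m a 2)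
  allowed (2+a<b ∷ _) (iv _ _ b≤2+a)   = <⇒≱ 2+a<b b≤2+a
  allowed (2+a<b ∷ _) (v _ refl _)     = <-irrefl refl 2+a<b

repeat-∷ : ∀ {a π} → 0 < a → Odd a → 𝒫-from (3 + a) π → 𝒫 (a ∷ a ∷ π)
repeat-∷ {a} 0<a odd-a s@(p , far) =
  𝒫-∷ 0<a (λ { refl → ≤-refl , (λ eq → 0≢1+n (trans (sym (∣n-n∣≡0 a)) eq)) , λ 2∣a _ → odd⇒¬even odd-a 2∣a })
    (λ { refl → allowed far }) (gap-∷ 0<a (weaken (n≤1+n _) s))
  where
  allowed : ∀ {c ρ} → All (3 + a <_) (c ∷ ρ) → ¬ Forbidden a a c
  allowed (3+a<c ∷ _) (iii _ _ c≤3+a) = <⇒≱ 3+a<c c≤3+a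
  allowed (3+a<c ∷ _) (iv _ refl _)   = <⇒≱ 3+a<c (m≤n+m a 3)
  allowed _           (v _ a≡2+a _)   = <⇒≢ (m≤n+m (suc a) 1) a≡2+a

step-∷ : ∀ {a π} → 0 < a → 𝒫-from (4 + a) π → 𝒫 (a ∷ 2 + a ∷ π)
step-∷ {a} 0<a s@(p , far) =
  𝒫-∷ 0<a (λ { refl → adjacent-far ≤-refl }) (λ { refl → allowed far }) (gap-∷ z<s s)
  where
  allowed : ∀ {c ρ} → All (4 + a <_) (c ∷ ρ) → ¬ Forbidden a (2 + a) c
  allowed _           (iii _ a≡2+a _) = <⇒≢ (m≤n+m (suc a) 1) a≡2+a
  allowed (4+a<c ∷ _) (iv _ refl _)   = <⇒≱ 4+a<c (m≤n+m (2 + a) 2)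
  allowed (4+a<c ∷ _) (v _ _ refl)    = <-irrefl refl 4+a<c

-- Soundness of the enumeration and absence of repetitions

listF-sound : ∀ d {e} → 2 ∣ e → All (𝒫-from e) (listF d e)
listG-sound : ∀ d {e} → 2 ∣ e → All (𝒫-from (1 + e)) (listG d e)

listF-sound zero    2∣e = (𝒫-[] , []) ∷ []
listF-sound (suc d) {e} 2∣e = All.++⁺ (All.map (weaken (n≤1+n e)) (listG-sound (suc d) 2∣e))
  (All.map⁺ (All.map (𝒫-from-∷ ≤-refl) (All.++⁺
    (All.map (gap-∷ z<s) (listG-sound d (even-2+ 2∣e)))
    (All.++⁺
      (All.map⁺ (All.map (repeat-∷ z<s (even⇒1+odd 2∣e)) (listF-sound d (even-2+ (even-2+ 2∣e)))))
      (All.map⁺ (All.map (step-∷ z<s) (listG-sound d (even-2+ (even-2+ 2∣e)))))))))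
listG-sound zero    2∣e = (𝒫-[] , []) ∷ []
listG-sound (suc d) {e} 2∣e = All.++⁺
  (All.map (weaken (n≤1+n (1 + e))) (listF-sound d (even-2+ 2∣e)))
  (All.map⁺ (All.map (𝒫-from-∷ ≤-refl ∘ even-∷ z<s (even-2+ 2∣e)) (listG-sound d (even-2+ 2∣e))))

disjoint-∷ : ∀ {a l πs ρs} → a ≤ l → All (𝒫-from l) πs → Disjoint πs (map (a ∷_) ρs)
disjoint-∷ a≤l ps (π∈πs , π∈map) with _ , _ , refl ← ∈-map⁻ (_ ∷_) π∈map
  with _ , l<a ∷ _ ← All.lookup ps π∈πs = <⇒≱ l<a a≤l

disjoint-∷-∷ : ∀ {a b} {πs ρs : List (List ℕ)} → a ≢ b → Disjoint (map (a ∷_) πs) (map (b ∷_) ρs)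
disjoint-∷-∷ a≢b (∈πs , ∈ρs)
  with _ , _ , refl ← ∈-map⁻ (_ ∷_) ∈πs | _ , _ , eq ← ∈-map⁻ (_ ∷_) ∈ρs = a≢b (List.∷-injectiveˡ eq)

disjoint-++ : ∀ {xs} (ys zs : List (List ℕ)) → Disjoint xs ys → Disjoint xs zs → Disjoint xs (ys ++ zs)
disjoint-++ ys zs p r (∈xs , ∈++) with ∈-++⁻ ys ∈++
... | inj₁ ∈ys = p (∈xs , ∈ys)
... | inj₂ ∈zs = r (∈xs , ∈zs)

∷-unique : ∀ a {πs : List (List ℕ)} → Unique πs → Unique (map (a ∷_) πs)
∷-unique a = Unique.map⁺ List.∷-injectiveʳ

listF-unique : ∀ d {e} → 2 ∣ e → Unique (listF d e)
listG-unique : ∀ d {e} → 2 ∣ e → Unique (listG d e)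

listF-unique zero    2∣e = [] ∷ []
listF-unique (suc d) {e} 2∣e =
  Unique.++⁺ (listG-unique (suc d) 2∣e) (∷-unique (1 + e) listK-unique)
    (disjoint-∷ ≤-refl (listG-sound (suc d) 2∣e))
  where
  2∣2+e = even-2+ 2∣e
  listK-unique : Unique (listK d e)
  listK-unique = Unique.++⁺ (listG-unique d 2∣2+e)
    (Unique.++⁺ (∷-unique (1 + e) (listF-unique d (even-2+ 2∣2+e)))
                (∷-unique (3 + e) (listG-unique d (even-2+ 2∣2+e)))
                (disjoint-∷-∷ (<⇒≢ (m≤n+m (2 + e) 1))))
    (disjoint-++ (map (1 + e ∷_) (listF d (4 + e))) (map (3 + e ∷_) (listG d (4 + e)))
                 (disjoint-∷ (m≤n+m (1 + e) 2) (listG-sound d 2∣2+e))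
                 (disjoint-∷ ≤-refl (listG-sound d 2∣2+e)))
listG-unique zero    2∣e = [] ∷ []
listG-unique (suc d) {e} 2∣e =
  Unique.++⁺ (listF-unique d (even-2+ 2∣e)) (∷-unique (2 + e) (listG-unique d (even-2+ 2∣e)))
    (disjoint-∷ ≤-refl (listF-sound d (even-2+ 2∣e)))

-- Completeness of the enumeration

[]∈listF : ∀ d e → [] ∈ listF d e
[]∈listG : ∀ d e → [] ∈ listG d e
[]∈listF zero    e = here refl
[]∈listF (suc d) e = ∈-++⁺ˡ ([]∈listG (suc d) e)
[]∈listG zero    e = here refl
[]∈listG (suc d) e = ∈-++⁺ˡ ([]∈listF d (2 + e))

𝒫-from-if : ∀ {l π} → 𝒫 π → (∀ {b ρ} → π ≡ b ∷ ρ → l < b) → 𝒫-from l π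
𝒫-from-if {π = []}    p _   = p , []
𝒫-from-if {π = _ ∷ _} p l<b = 𝒫-from-∷ (l<b refl) p

after-even : ∀ {a π} → 2 ∣ a → 𝒫 (a ∷ π) → 𝒫-from (1 + a) π
after-even 2∣a p = 𝒫-from-if (𝒫-tail p) λ { refl →
  adjacent⇒far (𝒫-adjacent p) (proj₂ (proj₂ (𝒫-adjacent p)) 2∣a) }

after-repeat : ∀ {a π} → Odd a → 𝒫 (a ∷ a ∷ π) → 𝒫-from (3 + a) π
after-repeat odd-a p = 𝒫-from-if (𝒫-tail (𝒫-tail p)) λ { refl →
  ≰⇒> λ c≤3+a → 𝒫-allowed p (iii odd-a refl c≤3+a) }

-- The next part cannot be 2 + a by (iv) with t = 2, 3 + a by (i), or 4 + a by (v).
after-step : ∀ {a π} → Odd a → Odd (2 + a) → 𝒫 (a ∷ 2 + a ∷ π) → 𝒫-from (4 + a) π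
after-step odd-a odd-2+a p = 𝒫-from-if (𝒫-tail (𝒫-tail p)) λ { refl →
  ≤∧≢⇒< (adjacent⇒far (𝒫-adjacent (𝒫-tail p)) λ 2+a≡c → 𝒫-allowed p (iv odd-2+a 2+a≡c ≤-refl))
    λ { refl → 𝒫-allowed p (v odd-a refl refl) } }

sum-tail : ∀ a π {l} → sum (a ∷ π) < l → sum π < l
sum-tail a π = ≤-<-trans (m≤n+m (sum π) a)

-- Settles the case without fuel: a nonempty partition with parts above the bound already has too
-- large a sum.
∷-not-small : ∀ {l a} π {A : Set} → l < a → sum (a ∷ π) < l + 0 → A
∷-not-small {l} {a} π l<a sum<l = contradiction
  (<-≤-trans (≤-<-trans (m≤m+n a (sum π)) sum<l) (≤-reflexive (+-identityʳ l))) (<⇒≯ l<a)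

-- As `e` stays even, 1 + e is always the odd candidate for the smallest part and 2 + e the even
-- one.
listF-complete : ∀ d {e} π → 2 ∣ e → 𝒫-from e π → sum π < e + d → π ∈ listF d e
listG-complete : ∀ d {e} π → 2 ∣ e → 𝒫-from (1 + e) π → sum π < e + d → π ∈ listG d e
listG⁺-complete : ∀ d {e} π → 2 ∣ e → 𝒫-from (1 + e) π → sum π < e + suc d → π ∈ listG (suc d) e
listK-complete : ∀ d {e} π → 2 ∣ e → 𝒫 (1 + e ∷ π) → sum π < 2 + e + d → π ∈ listK d e

listF-complete d {e} [] _ _ _ = []∈listF d e
listF-complete zero    (a ∷ π) _ (_ , e<a ∷ _) sum< = ∷-not-small π e<a sum<
listF-complete (suc d) {e} (a ∷ π) 2∣e (p , e<a ∷ _) sum< with a ≟ 1 + e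
... | yes refl = ∈-++⁺ʳ (listG (suc d) e)
  (∈-map⁺ (1 + e ∷_) (listK-complete d π 2∣e p (≤-fuel d e (sum-tail a π sum<))))
... | no a≢1+e = ∈-++⁺ˡ
  (listG⁺-complete d (a ∷ π) 2∣e (𝒫-from-∷ (≤∧≢⇒< e<a (a≢1+e ∘ sym)) p) sum<)

listG-complete d {e} [] _ _ _ = []∈listG d e
listG-complete zero    (a ∷ π) _ (_ , 1+e<a ∷ _) sum< = ∷-not-small π (<⇒≤ 1+e<a) sum<
listG-complete (suc d) = listG⁺-complete d

listG⁺-complete d {e} [] _ _ _ = []∈listG (suc d) e
listG⁺-complete d {e} (a ∷ π) 2∣e (p , 1+e<a ∷ _) sum< with a ≟ 2 + e
... | yes refl = ∈-++⁺ʳ (listF d (2 + e))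
  (∈-map⁺ (2 + e ∷_) (listG-complete d π (even-2+ 2∣e) (after-even (even-2+ 2∣e) p)
    (≤-fuel d e (sum-tail a π sum<))))
... | no a≢2+e = ∈-++⁺ˡ
  (listF-complete d (a ∷ π) (even-2+ 2∣e) (𝒫-from-∷ (≤∧≢⇒< 1+e<a (a≢2+e ∘ sym)) p) (≤-fuel d e sum<))

listK-complete d {e} [] _ _ _ = ∈-++⁺ˡ ([]∈listG d (2 + e))
listK-complete d {e} (b ∷ π) 2∣e p sum< with b ≟ 1 + e | b ≟ 3 + e
... | yes refl | _ = ∈-++⁺ʳ (listG d (2 + e)) (∈-++⁺ˡ (∈-map⁺ (1 + e ∷_)
  (listF-complete d π (even-2+ (even-2+ 2∣e)) (after-repeat (even⇒1+odd 2∣e) p)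
    (m≤n⇒m≤1+n (m≤n⇒m≤1+n (sum-tail b π sum<))))))
... | no _ | yes refl = ∈-++⁺ʳ (listG d (2 + e)) (∈-++⁺ʳ (map (1 + e ∷_) (listF d (4 + e)))
  (∈-map⁺ (3 + e ∷_) (listG-complete d π (even-2+ (even-2+ 2∣e))
    (after-step (even⇒1+odd 2∣e) (even⇒1+odd (even-2+ 2∣e)) p)
    (m≤n⇒m≤1+n (m≤n⇒m≤1+n (sum-tail b π sum<))))))
-- The gap condition also excludes 2 + e, so `b` exceeds 3 + e.
... | no b≢1+e | no b≢3+e = ∈-++⁺ˡ (listG-complete d (b ∷ π) (even-2+ 2∣e)
  (𝒫-from-∷ (≤∧≢⇒< (adjacent⇒far (𝒫-adjacent p) (b≢1+e ∘ sym)) (b≢3+e ∘ sym)) (𝒫-tail p)) sum<)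

-- The two identities

weight-≢ : ∀ π m {n} → n ≢ sum π → weight π m n ≡ 0ℤ
weight-≢ π m {n} n≢ with m ≡ᵇ length π
... | false = refl
... | true rewrite dec-false (n ≟ sum π) n≢ = refl

partitions-sum : ∀ {I : List ℕ → Set} {S} (πs : ℕ → List (List ℕ)) →
  (∀ n → Unique (πs n)) → (∀ n → All I (πs n)) →
  (∀ n π → I π → sum π ≡ n → π ∈ πs n) →
  (∀ n m → weights (πs n) m n ≡ S m n) → HasSum I weight S
partitions-sum πs unique sound complete value = hasSum (λ _ n → πs n) (λ _ → unique) (λ _ → sound)
  (λ m n π Iπ π∉ → weight-≢ π m (π∉ ∘ complete n π Iπ ∘ sym)) (λ m n → value n m)

-- Fuel `suc n` at e = 0 gives the bound suc n, just enough for the coefficient of qⁿ; positivity of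
-- the parts is the condition that they exceed e.
𝒫-sum : HasSum 𝒫 weight (F 0)
𝒫-sum = partitions-sum (λ n → listF (suc n) 0) (λ n → listF-unique (suc n) (2 ∣0))
  (λ n → All.map proj₁ (listF-sound (suc n) (2 ∣0)))
  (λ { n π p refl → listF-complete (suc n) π (2 ∣0)
         (p , IsPartition.positive (𝒫.isPartition p)) ≤-refl })
  (λ n m → weights-listF (suc n) 0 ≤-refl m n ≤-refl)

𝒫′-sum : HasSum 𝒫′ weight (G 0)
𝒫′-sum = partitions-sum (λ n → listG (suc n) 0) (λ n → listG-unique (suc n) (2 ∣0))
  (λ n → All.map (λ (p , 1<) → p , λ 1∈π → <-irrefl refl (All.lookup 1< 1∈π)) (listG-sound (suc n) (2 ∣0)))
  (λ { n π (p , 1∉π) refl → listG-complete (suc n) π (2 ∣0)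
         (p , All.tabulate λ {a} a∈π → ≤∧≢⇒< (All.lookup (IsPartition.positive (𝒫.isPartition p)) a∈π)
                                             (λ { refl → 1∉π a∈π })) ≤-refl })
  (λ n m → weights-listG (suc n) 0 ≤-refl m n ≤-refl)

triples-sum : ∀ (e : ℕ × ℕ × ℕ → ℕ) a b c → (∀ i j k → e (i , j , k) ≡ power 0 a b c (i , j , k)) →
              HasSum U (summand e) (h 0 a b c)
triples-sum e a b c e≡ = hasSum (λ m _ → triples m) (λ m _ → triples-unique m)
  (λ m _ → All.universal (λ _ → tt) (triples m))
  (λ m n t@(i , j , k) _ t∉ → x^∙-≢ {m} {N t} (((-1ℤ ℤ.^ k) ∙q^ e t) / denominator t) n
    λ { refl → t∉ (∈-triples i j k) })
  (λ m n → total-cong (All.map (λ { {t@(i , j , k)} refl → trans (x^∙-≡ (N t) _ n)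
    (trans (∙q^-· (-1ℤ ℤ.^ k) (e t) (inverse (denominator t)) n)
           (cong (λ p → (q^ p ∗ coefficient t) n) (e≡ i j k))) }) (triples-N m)))

mainTheorem4 : (∃[ S ] (HasSum 𝒫 weight S × HasSum U (summand exponent) S)) ×
    (∃[ S ] (HasSum 𝒫′ weight S × HasSum U (summand exponent′) S))
mainTheorem4 =
  (F 0 , 𝒫-sum , triples-sum exponent 1 0 0 λ i j k → lemma (falling₂ (N (i , j , k))) i j k) ,
  (G 0 , 𝒫′-sum , triples-sum exponent′ 2 4 6 λ i j k → lemma′ (falling₂ (N (i , j , k))) i j k)
  where
  lemma : ∀ p i j k → p + i + 3 * (k * (k * 1)) ≡
    p + ((1 + 0) * i + (0 + 2 * 0) * j + (0 + 3 * 0) * k + 3 * (k * k))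
  lemma = ℕ-Solver.solve-∀
  lemma′ : ∀ p i j k → p + 2 * i + 4 * j + 3 * (k * (k * 1)) + 6 * k ≡
    p + ((2 + 0) * i + (4 + 2 * 0) * j + (6 + 3 * 0) * k + 3 * (k * k))
  lemma′ = ℕ-Solver.solve-∀
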